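{- Let $k\ge 1$ be an integer and let $G$ be a graph on $n$ vertices such that no induced subgraph of $G$ is an immature $k$-creature. Then $G$ has $\mathcal{O}(n^{2k-2})$ minimal separators, and they can be enumerated in time $\mathcal{O}(n^{2k})$.
   Context: All graphs are finite and simple. A graph is an immature $k$-creature if its vertex set can be partitioned into $X=\{x_1,\dots,x_k\}$ and $Y=\{y_1,\dots,y_k\}$ such that the only edges between $X$ and $Y$ are the edges $x_iy_i$, $i=1,\dots,k$ (edges inside $X$ and inside $Y$ are unrestricted). A set $C\subseteq V(G)$ is a minimal separator of $G$ if there are two distinct connected components $L,R$ of $G\setminus C$ with $N(L)=N(R)=C$, where $N(Z)$ is the set of vertices outside $Z$ with a neighbor in $Z$. -}

module Defs where

open import Data.Bool using (Bool; true; false; T; if_then_else_; _∧_)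
open import Data.Fin using (Fin; fromℕ<)
open import Data.Fin.Subset using (Subset; _∈_; _∉_)
open import Data.List using (List; []; _∷_; _++_; map; concatMap)
open import Data.List.Membership.Propositional using () renaming (_∈_ to _∈ˡ_)
open import Data.List.Relation.Unary.Unique.Propositional using (Unique)
open import Data.Nat using (ℕ; suc; pred; _+_; _<ᵇ_; _≡ᵇ_; _<?_)
open import Data.Product using (Σ-syntax; ∃; ∃-syntax; _×_; proj₁)
open import Data.Sum using (_⊎_; inj₁; inj₂)
open import Data.Vec using (toList)
open import Function.Bundles using (_⇔_; _↔_; module Inverse)
open import Level using (0ℓ)
open import Relation.Binary.Construct.Closure.ReflexiveTransitive using (Star)
open import Relation.Binary.PropositionalEquality using (_≡_; _≢_)
open import Relation.Nullary using (¬_; yes; no)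
open import Relation.Unary using (Pred; _≐_)

------------------------------------------------------------------------
-- Graphs

record Graph (V : Set) : Set where
  field
    adj        : V → V → Bool
    adj-sym    : ∀ u v → adj u v ≡ adj v u
    adj-irrefl : ∀ v → adj v v ≡ false

  Adj : V → V → Set
  Adj u v = T (adj u v)

open Graph public

FinGraph : ℕ → Set
FinGraph n = Graph (Fin n)

_[_] : ∀ {n} → FinGraph n → (S : Subset n) → Graph (∃[ v ] v ∈ S)
G [ S ] = record
  { adj        = λ u v → adj G (proj₁ u) (proj₁ v)
  ; adj-sym    = λ u v → adj-sym G (proj₁ u) (proj₁ v)
  ; adj-irrefl = λ v → adj-irrefl G (proj₁ v)
  }

-- The bijection φ encodes the partition of the vertex set:
-- xᵢ = φ (inj₁ i) and yⱼ = φ (inj₂ j).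
IsImmatureCreature : ℕ → {V : Set} → Graph V → Set
IsImmatureCreature k {V} H =
  Σ[ φ ∈ (Fin k ⊎ Fin k) ↔ V ]
    (∀ i j → Adj H (Inverse.to φ (inj₁ i)) (Inverse.to φ (inj₂ j)) ⇔ i ≡ j)

ImmatureCreatureFree : ℕ → ∀ {n} → FinGraph n → Set
ImmatureCreatureFree k {n} G =
  ∀ (S : Subset n) → ¬ IsImmatureCreature k (G [ S ])

module _ {n : ℕ} (G : FinGraph n) where

  N : Subset n → Pred (Fin n) 0ℓ
  N Z u = u ∉ Z × ∃[ v ] (v ∈ Z × Adj G u v)

  -- Reachable C u v: there is a walk from u to v in G ∖ C (provided u ∉ C).
  Reachable : Subset n → Fin n → Fin n → Set
  Reachable C = Star (λ u v → u ∉ C × v ∉ C × Adj G u v)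

  -- L is the vertex set of a connected component of G ∖ C.
  IsComponent : Subset n → Subset n → Set
  IsComponent C L = ∃[ v ] (v ∉ C × (_∈ L) ≐ Reachable C v)

  IsMinimalSeparator : Subset n → Set
  IsMinimalSeparator C =
    ∃[ L ] ∃[ R ] ( IsComponent C L × IsComponent C R × L ≢ R
                  × N L ≐ (_∈ C) × N R ≐ (_∈ C) )

-- The list consists of exactly the elements satisfying P, each occurring once;
-- its length is therefore the number of such elements.
Lists : {A : Set} → List A → (A → Set) → Set
Lists {A} as P = Unique as × (∀ (a : A) → a ∈ˡ as ⇔ P a)

------------------------------------------------------------------------
-- Machine model
--
-- A random access machine, presented as a structured language.  The input
-- graph is a read-only adjacency matrix (together with its order n), the
-- working memory is a family of arrays of natural numbers, initially all 0,
-- and the output is a write-only sequence of numbers.  A program mentions only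
-- finitely many arrays; a scalar variable is an array used at one index.
--
-- Each operation has unit cost.  The only growing arithmetic operation is the
-- successor, so in t steps no value exceeds n + O(t): a computation of time
-- polynomial in n uses words of O(log n) bits only.

data Exp : Set where
  lit   : ℕ → Exp
  order : Exp
  _!_   : ℕ → Exp → Exp
  inc   : Exp → Exp
  dec   : Exp → Exp
  lt    : Exp → Exp → Exp
  eq    : Exp → Exp → Exp
  edge  : Exp → Exp → Exp

data Cmd : Set where
  skip            : Cmd
  _!_≔_           : ℕ → Exp → Exp → Cmd
  print           : Exp → Cmd
  _⨟_             : Cmd → Cmd → Cmd
  ifnz_then_else_ : Exp → Cmd → Cmd → Cmd
  whilenz_loop_   : Exp → Cmd → Cmd

infixr 25 _!_
infix  20 _!_≔_
infix  15 ifnz_then_else_ whilenz_loop_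
infixr 10 _⨟_

Store : Set
Store = ℕ → ℕ → ℕ

empty : Store
empty _ _ = 0

_[_,_↦_] : Store → ℕ → ℕ → ℕ → Store
(s [ a , i ↦ v ]) b j = if (b ≡ᵇ a) ∧ (j ≡ᵇ i) then v else s b j

bit : Bool → ℕ
bit b = if b then 1 else 0

-- Entries outside the matrix read as 0.
edgeBit : ∀ {n} → FinGraph n → ℕ → ℕ → ℕ
edgeBit {n} G i j with i <? n | j <? n
... | yes i<n | yes j<n = bit (adj G (fromℕ< i<n) (fromℕ< j<n))
... | _       | _       = 0

eval : ∀ {n} → FinGraph n → Store → Exp → ℕ
eval     G s (lit m)    = m
eval {n} G s order      = n
eval     G s (a ! e)    = s a (eval G s e)
eval     G s (inc e)    = suc (eval G s e)
eval     G s (dec e)    = pred (eval G s e)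
eval     G s (lt e f)   = bit (eval G s e <ᵇ eval G s f)
eval     G s (eq e f)   = bit (eval G s e ≡ᵇ eval G s f)
eval     G s (edge e f) = edgeBit G (eval G s e) (eval G s f)

cost : Exp → ℕ
cost (lit _)    = 1
cost order      = 1
cost (_ ! e)    = suc (cost e)
cost (inc e)    = suc (cost e)
cost (dec e)    = suc (cost e)
cost (lt e f)   = suc (cost e + cost f)
cost (eq e f)   = suc (cost e + cost f)
cost (edge e f) = suc (cost e + cost f)

-- Run G p s t out s′: on input G, program p started in store s halts after
-- time t in store s′, having printed out.
data Run {n : ℕ} (G : FinGraph n) :
         Cmd → Store → ℕ → List ℕ → Store → Set where

  run-skip : ∀ {s} → Run G skip s 1 [] s

  run-assign : ∀ {s a e f} →
    Run G (a ! e ≔ f) s (suc (cost e + cost f)) []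
        (s [ a , eval G s e ↦ eval G s f ])

  run-print : ∀ {s e} →
    Run G (print e) s (suc (cost e)) (eval G s e ∷ []) s

  run-seq : ∀ {s s′ s″ p q t u out out′} →
    Run G p s t out s′ → Run G q s′ u out′ s″ →
    Run G (p ⨟ q) s (t + u) (out ++ out′) s″

  run-then : ∀ {s s′ e p q t out} →
    eval G s e ≢ 0 → Run G p s t out s′ →
    Run G (ifnz e then p else q) s (suc (cost e + t)) out s′

  run-else : ∀ {s s′ e p q t out} →
    eval G s e ≡ 0 → Run G q s t out s′ →
    Run G (ifnz e then p else q) s (suc (cost e + t)) out s′

  run-stop : ∀ {s e p} →
    eval G s e ≡ 0 →
    Run G (whilenz e loop p) s (suc (cost e)) [] s

  run-loop : ∀ {s s′ s″ e p t u out out′} →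
    eval G s e ≢ 0 → Run G p s t out s′ →
    Run G (whilenz e loop p) s′ u out′ s″ →
    Run G (whilenz e loop p) s (suc (cost e) + t + u) (out ++ out′) s″

-- Vertex sets are written one after the other as 0/1 characteristic vectors.
encode : ∀ {n} → List (Subset n) → List ℕ
encode = concatMap (λ S → map bit (toList S))

Prints : ∀ {n} → Cmd → FinGraph n → List (Subset n) → ℕ → Set
Prints p G Cs t = ∃[ s ] Run G p empty t (encode Cs) s

{-# OPTIONS --safe #-}
module Submission where

-- Let C be a minimal separator with full components L and R.  A smallest tuple of
-- vertices of L dominating C gives every entry a private neighbour in C, so k
-- entries would induce an immature k-creature; hence k - 1 vertices of L dominate
-- C, and likewise for R.  As no vertex outside C is adjacent to both L and R, the
-- separator C is exactly the set of common neighbours of the two (k - 1)-tuples,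
-- which leaves at most n ^ (2k - 2) separators.
--
-- To enumerate them, run through all pairs of (k - 1)-tuples.  The set C of their
-- common neighbours is a minimal separator with the first entries of the tuples
-- in different full components iff two graph searches, in time O(n ^ 2), say so;
-- a binary trie detects in time O(n) whether C has been printed before.  For
-- k = 1 the graph has no edges, and only the empty set can be a separator.

open import Defs
open import Data.Bool using (Bool; true; false; T; not; _∧_; _∨_)
open import Data.Bool.Properties using (T?)
open import Data.Empty using (⊥; ⊥-elim)
open import Data.Fin using (Fin; zero; suc; toℕ; fromℕ<; punchIn; punchOut; inject≤)
import Data.Fin.Properties as Fin
open import Data.Fin.Subset using (Subset; _∈_; _∉_; _⊆_; _∪_; ⁅_⁆; ∣_∣) renaming (⊥ to ∅)
open import Data.Fin.Subset.Properties
  using (_∈?_; ⊆-antisym; x∈⁅x⁆; x∈⁅y⁆⇒x≡y; x∈p∪q⁺; x∈p∪q⁻; p⊂q⇒∣p∣<∣q∣; ∣p∣≤n; ∣p∣≡n⇒p≡⊤; ∈⊤; ∉⊥)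
open import Data.List using (List; []; _∷_; _++_; length; map; drop)
import Data.List.Properties as List
open import Data.List.Membership.Propositional using () renaming (_∈_ to _∈ˡ_)
open import Data.List.Membership.Propositional.Properties using (∈-++⁺ˡ; ∈-++⁺ʳ; ∈-++⁻)
open import Data.List.Relation.Unary.Any using (here)
import Data.List.Relation.Unary.All as All
open import Data.List.Relation.Unary.AllPairs using ([]; _∷_)
open import Data.List.Relation.Unary.Unique.Propositional using (Unique)
import Data.List.Relation.Unary.Unique.Propositional.Properties as Unique
open import Data.Nat
open import Data.Nat.Properties hiding (_≟_; _≤?_; _<?_)
open import Data.Product using (∃-syntax; _×_; _,_; proj₁; proj₂)
open import Data.Sum using (_⊎_; inj₁; inj₂; [_,_]′)
open import Data.Unit using (⊤; tt)
open import Data.Vec using ([]; _∷_; here; there; lookup; tabulate; toList)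
open import Data.Vec.Properties using ([]=⇒lookup; lookup⇒[]=; lookup∘tabulate; tabulate-cong)
open import Function using (_∘_)
open import Function.Bundles using (_⇔_; mk⇔; mk↔ₛ′; module Equivalence)
open import Relation.Binary.Construct.Closure.ReflexiveTransitive using (ε; _◅_; _◅◅_; reverse)
open import Relation.Binary.PropositionalEquality hiding ([_])
open import Relation.Nullary
  using (¬_; ¬?; Dec; does; yes; no; contradiction; map′; _⊎-dec_; _×-dec_; _→-dec_)
open import Relation.Nullary.Decidable using (dec-true; decidable-stable)
open import Relation.Unary using (Decidable; _≐_)

-- Structured programs whose loops run a counter through all vertices

-- The machine offers only `whilenz`, for which termination and time would have to be argued anew
-- for each loop. So the algorithm is written with loops that make exactly n iterations: a program
-- is then a total function on stores, and its time is at most a constant times n to the power of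
-- its loop depth. The price is that nothing stops early; a search makes n rounds even if it is
-- finished before. Since k is fixed, every tuple entry has a loop and an array of its own: 2k - 2
-- loops around a body of depth 2 give the exponent 2k.
--
-- Different tuples may yield the same separator, and comparing it with everything printed so far
-- could cost far more than O(n ^ 2). This is why a trie is used: an insertion costs the same
-- however many sets are stored, and nodes can be numbered with the successor alone, the only
-- growing arithmetic of the machine.
--
-- Reachability is not decided separately. The specifications of the programs carry decisions, and
-- the searches deliver the components as finite sets. The count comes from the same run: each tuple
-- adds at most one set to the output.

infixr 10 _▸_

-- The counter of  for x p  is the cell 0 of the array x.
data Prog : Set where
  asg  : ℕ → Exp → Exp → Prog
  prt  : Exp → Prog
  nop  : Prog
  _▸_  : Prog → Prog → Prog
  cond : Exp → Prog → Prog → Prog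
  for  : ℕ → Prog → Prog

compile : Prog → Cmd
compile (asg a e f)  = a ! e ≔ f
compile (prt e)      = print e
compile nop          = skip
compile (p ▸ q)      = compile p ⨟ compile q
compile (cond e p q) = ifnz e then compile p else compile q
compile (for x p)    =
  x ! lit 0 ≔ lit 0 ⨟
  whilenz lt (x ! lit 0) order loop (compile p ⨟ x ! lit 0 ≔ inc (x ! lit 0))

-- Freshness is a computed type: for a concrete program it reduces to a product of unit types, so
-- its proofs can be written `_`.
Fresh : ℕ → Prog → Set
Fresh b (asg a e f)  = T (not (b ≡ᵇ a))
Fresh b (prt e)      = ⊤
Fresh b nop          = ⊤
Fresh b (p ▸ q)      = Fresh b p × Fresh b q
Fresh b (cond e p q) = Fresh b p × Fresh b q
Fresh b (for x p)    = T (not (b ≡ᵇ x)) × Fresh b p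

WellFormed : Prog → Set
WellFormed (asg a e f)  = ⊤
WellFormed (prt e)      = ⊤
WellFormed nop          = ⊤
WellFormed (p ▸ q)      = WellFormed p × WellFormed q
WellFormed (cond e p q) = WellFormed p × WellFormed q
WellFormed (for x p)    = Fresh x p × WellFormed p

Silent : Prog → Set
Silent (asg a e f)  = ⊤
Silent (prt e)      = ⊥
Silent nop          = ⊤
Silent (p ▸ q)      = Silent p × Silent q
Silent (cond e p q) = Silent p × Silent q
Silent (for x p)    = Silent p

depth : Prog → ℕ
depth (asg a e f)  = 0
depth (prt e)      = 0
depth nop          = 0
depth (p ▸ q)      = depth p ⊔ depth q
depth (cond e p q) = depth p ⊔ depth q
depth (for x p)    = suc (depth p)

-- A loop spends 3 on resetting the counter, 5 on each of its n + 1 tests and 5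
-- on each of its n increments.
time : Prog → ℕ → ℕ
time (asg a e f)  n = suc (cost e + cost f)
time (prt e)      n = suc (cost e)
time nop          n = 1
time (p ▸ q)      n = time p n + time q n
time (cond e p q) n = suc (cost e + (time p n + time q n))
time (for x p)    n = 8 + n * (10 + time p n)

coeff : Prog → ℕ
coeff (asg a e f)  = suc (cost e + cost f)
coeff (prt e)      = suc (cost e)
coeff nop          = 1
coeff (p ▸ q)      = coeff p + coeff q
coeff (cond e p q) = suc (cost e) + (coeff p + coeff q)
coeff (for x p)    = 8 + (10 + coeff p)

raise : ∀ c n .{{_ : NonZero n}} {d e t} → d ≤ e → t ≤ c * n ^ d → t ≤ c * n ^ e
raise c n d≤e t≤ = ≤-trans t≤ (*-monoʳ-≤ c (^-monoʳ-≤ n d≤e))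

const≤ : ∀ c n .{{_ : NonZero n}} d → c ≤ c * n ^ d
const≤ c n d = raise c n {e = d} z≤n (≤-reflexive (sym (*-identityʳ c)))

add≤ : ∀ c c′ x {t t′} → t ≤ c * x → t′ ≤ c′ * x → t + t′ ≤ (c + c′) * x
add≤ c c′ x p q = ≤-trans (+-mono-≤ p q) (≤-reflexive (sym (*-distribʳ-+ x c c′)))

mul≤ : ∀ c n d {t} → t ≤ c * n ^ d → n * t ≤ c * n ^ suc d
mul≤ c n d {t} p = begin
  n * t             ≤⟨ *-monoʳ-≤ n p ⟩
  n * (c * n ^ d)   ≡⟨ sym (*-assoc n c (n ^ d)) ⟩
  n * c * n ^ d     ≡⟨ cong (_* n ^ d) (*-comm n c) ⟩
  c * n * n ^ d     ≡⟨ *-assoc c n (n ^ d) ⟩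
  c * (n * n ^ d)   ∎
  where open ≤-Reasoning

-- For n ≥ 1 every lower power of n is absorbed by the highest one, so only the loop depth of a
-- program enters the exponent.
time-bound : ∀ p n .{{_ : NonZero n}} → time p n ≤ coeff p * n ^ depth p
time-bound (asg a e f) n = const≤ _ n 0
time-bound (prt e)     n = const≤ _ n 0
time-bound nop         n = const≤ 1 n 0
time-bound (p ▸ q)     n =
  add≤ (coeff p) (coeff q) _
    (raise (coeff p) n (m≤m⊔n (depth p) (depth q)) (time-bound p n))
    (raise (coeff q) n (m≤n⊔m (depth p) (depth q)) (time-bound q n))
time-bound (cond e p q) n =
  add≤ (suc (cost e)) (coeff p + coeff q) (n ^ (depth p ⊔ depth q))
    (const≤ (suc (cost e)) n (depth p ⊔ depth q))
    (add≤ (coeff p) (coeff q) _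
      (raise (coeff p) n (m≤m⊔n (depth p) (depth q)) (time-bound p n))
      (raise (coeff q) n (m≤n⊔m (depth p) (depth q)) (time-bound q n)))
time-bound (for x p) n =
  add≤ 8 (10 + coeff p) (n ^ suc (depth p)) (const≤ 8 n (suc (depth p)))
    (mul≤ (10 + coeff p) n (depth p)
      (add≤ 10 (coeff p) (n ^ depth p) (const≤ 10 n (depth p)) (time-bound p n)))

-- Programs as functions on stores, and their agreement with the machine

branch : {A : Set} → ℕ → A → A → A
branch zero    x y = y
branch (suc _) x y = x

iterate : {A : Set} → (A → A) → A → ℕ → A
iterate f a zero    = a
iterate f a (suc i) = f (iterate f a i)

gather : {A : Set} → (ℕ → List A) → ℕ → List A
gather g zero    = []
gather g (suc i) = gather g i ++ g i

tick : ℕ → Store → Store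
tick x s = s [ x , 0 ↦ suc (s x 0) ]

≡ᵇ-refl : ∀ i → (i ≡ᵇ i) ≡ true
≡ᵇ-refl zero    = refl
≡ᵇ-refl (suc i) = ≡ᵇ-refl i

≢⇒≡ᵇ-false : ∀ {i j} → i ≢ j → (i ≡ᵇ j) ≡ false
≢⇒≡ᵇ-false {i} {j} i≢j with i ≡ᵇ j in i≡ᵇj
... | false = refl
... | true  = contradiction (≡ᵇ⇒≡ i j (subst T (sym i≡ᵇj) tt)) i≢j

≢⇒not : ∀ {i j} → i ≢ j → T (not (i ≡ᵇ j))
≢⇒not i≢j rewrite ≢⇒≡ᵇ-false i≢j = tt

update-other : ∀ s a i v {b} j → T (not (b ≡ᵇ a)) → (s [ a , i ↦ v ]) b j ≡ s b j
update-other s a i v {b} j b≢a with b ≡ᵇ a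
... | false = refl

update-same : ∀ s a i v → (s [ a , i ↦ v ]) a i ≡ v
update-same s a i v rewrite ≡ᵇ-refl a | ≡ᵇ-refl i = refl

update-index : ∀ s a i v {j} → j ≢ i → (s [ a , i ↦ v ]) a j ≡ s a j
update-index s a i v {j} j≢i rewrite ≡ᵇ-refl a | ≢⇒≡ᵇ-false j≢i = refl

module Semantics {n : ℕ} (G : FinGraph n) where

  run : Prog → Store → Store
  run (asg a e f)  s = s [ a , eval G s e ↦ eval G s f ]
  run (prt e)      s = s
  run nop          s = s
  run (p ▸ q)      s = run q (run p s)
  run (cond e p q) s = branch (eval G s e) (run p s) (run q s)
  run (for x p)    s = iterate (λ s → tick x (run p s)) (s [ x , 0 ↦ 0 ]) n

  states : ℕ → Prog → Store → ℕ → Store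
  states x p s = iterate (λ s → tick x (run p s)) (s [ x , 0 ↦ 0 ])

  out : Prog → Store → List ℕ
  out (asg a e f)  s = []
  out (prt e)      s = eval G s e ∷ []
  out nop          s = []
  out (p ▸ q)      s = out p s ++ out q (run p s)
  out (cond e p q) s = branch (eval G s e) (out p s) (out q s)
  out (for x p)    s = gather (λ i → out p (states x p s i)) n

  frame : ∀ p {b} → Fresh b p → ∀ s j → run p s b j ≡ s b j
  frame (asg a e f)  fr s j = update-other s a _ _ j fr
  frame (prt e)      fr s j = refl
  frame nop          fr s j = refl
  frame (p ▸ q)      (f , g) s j = trans (frame q g _ j) (frame p f s j)
  frame (cond e p q) (f , g) s j with eval G s e
  ... | zero  = frame q g s j
  ... | suc _ = frame p f s j
  frame (for x p) {b} (f , g) s j = go n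
    where
    go : ∀ i → states x p s i b j ≡ s b j
    go zero    = update-other s x 0 0 j f
    go (suc i) = trans (update-other (run p (states x p s i)) x 0 _ j f)
                       (trans (frame p g _ j) (go i))

  silent : ∀ p → Silent p → ∀ s → out p s ≡ []
  silent (asg a e f)  si s = refl
  silent nop          si s = refl
  silent (p ▸ q)      (u , v) s rewrite silent p u s = silent q v _
  silent (cond e p q) (u , v) s with eval G s e
  ... | zero  = silent q v s
  ... | suc _ = silent p u s
  silent (for x p)    si s = go n
    where
    go : ∀ i → gather (λ i → out p (states x p s i)) i ≡ []
    go zero = refl
    go (suc i) rewrite go i = silent p si _

  counter : ∀ x p → Fresh x p → ∀ s i → states x p s i x 0 ≡ i
  counter x p fr s zero    = update-same s x 0 0
  counter x p fr s (suc i) =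
    trans (update-same (run p (states x p s i)) x 0 _)
          (cong suc (trans (frame p fr _ 0) (counter x p fr s i)))

  -- The body leaves the counter alone, so the counter equals the number of completed iterations and
  -- the step may assume `s x 0 ≡ toℕ v`. This is the Hoare rule for counted loops, with invariants
  -- that may also speak of the output so far.
  for-invariant-out : ∀ x p (I : ℕ → List ℕ → Store → Set) {s} → Fresh x p →
    I 0 [] (s [ x , 0 ↦ 0 ]) →
    (∀ (v : Fin n) {o s} → s x 0 ≡ toℕ v → I (toℕ v) o s →
       I (suc (toℕ v)) (o ++ out p s) (tick x (run p s))) →
    I n (out (for x p) s) (run (for x p) s)
  for-invariant-out x p I {s} fr base step = go n ≤-refl
    where
    σ = states x p s
    outs : ℕ → List ℕ
    outs = gather (λ i → out p (σ i))
    go : ∀ i → i ≤ n → I i (outs i) (σ i)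
    go zero    _   = base
    go (suc i) i<n =
      subst (λ j → I (suc j) (outs (suc i)) (σ (suc i))) (Fin.toℕ-fromℕ< i<n)
        (step (fromℕ< i<n) (trans (counter x p fr s i) (sym (Fin.toℕ-fromℕ< i<n)))
          (subst (λ j → I j (outs i) (σ i)) (sym (Fin.toℕ-fromℕ< i<n)) (go i (<⇒≤ i<n))))

  for-invariant : ∀ x p (I : ℕ → Store → Set) {s} → Fresh x p →
    I 0 (s [ x , 0 ↦ 0 ]) →
    (∀ (v : Fin n) {s} → s x 0 ≡ toℕ v → I (toℕ v) s → I (suc (toℕ v)) (tick x (run p s))) →
    I n (run (for x p) s)
  for-invariant x p I fr base step =
    for-invariant-out x p (λ i _ → I i) fr base (λ v {_} {s} → step v {s})

  bit-<ᵇ-≢0 : ∀ {i j} → i < j → bit (i <ᵇ j) ≢ 0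
  bit-<ᵇ-≢0 {i} {j} i<j with i <ᵇ j in i<ᵇj
  ... | true  = λ ()
  ... | false = λ _ → subst T i<ᵇj (<⇒<ᵇ i<j)

  bit-<ᵇ-≡0 : ∀ {i j} → j ≤ i → bit (i <ᵇ j) ≡ 0
  bit-<ᵇ-≡0 {i} {j} j≤i with i <ᵇ j in i<ᵇj
  ... | false = refl
  ... | true  = contradiction (<ᵇ⇒< i j (subst T (sym i<ᵇj) tt)) (≤⇒≯ j≤i)

  Halts : Cmd → Store → ℕ → List ℕ → Store → Set
  Halts p s bound o s′ = ∃[ t ] (t ≤ bound × Run G p s t o s′)

  halts : ∀ p → WellFormed p → ∀ s → Halts (compile p) s (time p n) (out p s) (run p s)
  halts (asg a e f) wf s = _ , ≤-refl , run-assign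
  halts (prt e)     wf s = _ , ≤-refl , run-print
  halts nop         wf s = _ , ≤-refl , run-skip
  halts (p ▸ q) (u , v) s with halts p u s | halts q v (run p s)
  ... | _ , t≤ , r | _ , t′≤ , r′ = _ , +-mono-≤ t≤ t′≤ , run-seq r r′
  halts (cond e p q) (u , v) s with eval G s e in e≡
  ... | zero  with halts q v s
  ...   | _ , t≤ , r = _ , s≤s (+-monoʳ-≤ (cost e) (≤-trans t≤ (m≤n+m _ _))) , run-else e≡ r
  halts (cond e p q) (u , v) s | suc _ with halts p u s
  ...   | _ , t≤ , r = _ , s≤s (+-monoʳ-≤ (cost e) (≤-trans t≤ (m≤m+n _ _)))
                     , run-then (λ z → 0≢1+n (trans (sym z) e≡)) r
  halts (for x p) (fr , wf) s with go n 0 refl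
    where
    σ = states x p s
    outs : ℕ → List ℕ
    outs = gather (λ i → out p (σ i))
    body = compile p ⨟ x ! lit 0 ≔ inc (x ! lit 0)
    -- Here `d` iterations remain. A derivation for `whilenz` is nested towards later iterations,
    -- whereas `outs` grows at its end; hence the remaining output `o` is tied to `outs` by an
    -- equation. The 5 pays for the last test, which fails.
    go : ∀ d i → i + d ≡ n → ∃[ o ] (outs i ++ o ≡ outs n ×
         Halts (whilenz lt (x ! lit 0) order loop body) (σ i) (5 + d * (10 + time p n)) o (σ n))
    go zero i i≡n rewrite +-identityʳ i | i≡n =
      [] , List.++-identityʳ _ , _ , ≤-refl
         , run-stop (bit-<ᵇ-≡0 (≤-reflexive (sym (counter x p fr s n))))
    go (suc d) i i+d≡n with go d (suc i) (trans (sym (+-suc i d)) i+d≡n) | halts p wf (σ i)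
    ... | o , o≡ , t , t≤ , r | u , u≤ , r′ =
      _ , trans (sym (List.++-assoc (outs i) (out p (σ i)) o)) o≡ , _ , bound
        , run-loop (bit-<ᵇ-≢0 (subst (_< n) (sym (counter x p fr s i)) i<n))
                   (subst (λ o → Run G body (σ i) _ o (σ (suc i))) (List.++-identityʳ _)
                     (run-seq r′ run-assign)) r
      where
      i<n : i < n
      i<n = subst (i <_) i+d≡n (m<m+n i z<s)
      bound : 5 + (u + 5) + t ≤ 5 + suc d * (10 + time p n)
      bound = begin
        5 + (u + 5) + t                              ≡⟨ cong (_+ t) (sym (+-assoc 5 u 5)) ⟩
        5 + u + 5 + t                                ≡⟨ cong (_+ t) (+-comm (5 + u) 5) ⟩
        10 + u + t                                   ≤⟨ +-mono-≤ (+-monoʳ-≤ 10 u≤) t≤ ⟩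
        10 + time p n + (5 + d * (10 + time p n))    ≡⟨ sym (+-assoc (10 + time p n) 5 _) ⟩
        10 + time p n + 5 + d * (10 + time p n)      ≡⟨ cong (_+ d * (10 + time p n)) (+-comm (10 + time p n) 5) ⟩
        5 + (10 + time p n) + d * (10 + time p n)    ≡⟨ +-assoc 5 (10 + time p n) _ ⟩
        5 + suc d * (10 + time p n)                  ∎
        where open ≤-Reasoning
  ... | o , refl , t , t≤ , r = _ , +-monoʳ-≤ 3 t≤ , run-seq run-assign r

-- Dominating tuples and minimal separators

lookup⇒∈ : ∀ {n} {S : Subset n} {v} → lookup S v ≡ true → v ∈ S
lookup⇒∈ {S = S} {v} = lookup⇒[]= v S

∈⇒lookup : ∀ {n} {S : Subset n} {v} → v ∈ S → lookup S v ≡ true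
∈⇒lookup = []=⇒lookup

∉⇒lookup : ∀ {n} {S : Subset n} {v} → v ∉ S → lookup S v ≡ false
∉⇒lookup {S = S} {v} v∉S with lookup S v in S[v]
... | false = refl
... | true  = contradiction (lookup⇒∈ S[v]) v∉S

-- Vertices of an induced subgraph are pairs with a membership proof; irrelevance makes such pairs
-- equal as soon as the vertices are.
∈-irrelevant : ∀ {n} {S : Subset n} {v} (p q : v ∈ S) → p ≡ q
∈-irrelevant here      here      = refl
∈-irrelevant (there p) (there q) = cong there (∈-irrelevant p q)

-- A walk in the trie reads bits at numeric positions, so a vector is turned into a function on ℕ
-- with a default beyond its end.
nth : ∀ {n} → Subset n → ℕ → Bool
nth []      _       = false
nth (b ∷ S) zero    = b
nth (b ∷ S) (suc i) = nth S i

nth-toℕ : ∀ {n} (S : Subset n) v → nth S (toℕ v) ≡ lookup S v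
nth-toℕ (b ∷ S) zero    = refl
nth-toℕ (b ∷ S) (suc v) = nth-toℕ S v

nth-injective : ∀ {n} {S S′ : Subset n} → (∀ {i} → i < n → nth S i ≡ nth S′ i) → S ≡ S′
nth-injective {S = []}    {[]}     _   = refl
nth-injective {S = b ∷ S} {b′ ∷ S′} S≗ = cong₂ _∷_ (S≗ z<s) (nth-injective (λ i<n → S≗ (s<s i<n)))

module _ {n : ℕ} {P : Fin n → Set} (P? : Decidable P) where

  satisfying : Subset n
  satisfying = tabulate (λ v → does (P? v))

  ∈-satisfying⁺ : ∀ {v} → P v → v ∈ satisfying
  ∈-satisfying⁺ {v} p = lookup⇒∈ (trans (lookup∘tabulate _ v) (dec-true (P? v) p))

  ∈-satisfying⁻ : ∀ {v} → v ∈ satisfying → P v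
  ∈-satisfying⁻ {v} v∈ with P? v | trans (sym (lookup∘tabulate (λ v → does (P? v)) v)) (∈⇒lookup v∈)
  ... | yes p | _ = p

module GraphProperties {n : ℕ} (G : FinGraph n) where

  Adj-sym : ∀ {u v} → Adj G u v → Adj G v u
  Adj-sym {u} {v} = subst T (adj-sym G u v)

  Adj-irrefl : ∀ {v} → ¬ Adj G v v
  Adj-irrefl {v} = subst T (adj-irrefl G v)

  -- The matching condition already makes `x` and `y` injective: if x i = x i′, then x i is adjacent
  -- to y i′, whence i = i′. Only the disjointness of the two sides has to be assumed.
  creature : ∀ {k} (x y : Fin k → Fin n) → (∀ i j → x i ≢ y j) →
             (∀ i j → Adj G (x i) (y j) ⇔ i ≡ j) →
             ∃[ S ] IsImmatureCreature k (G [ S ])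
  creature {k} x y x≢y x~y = S , mk↔ₛ′ to from to∘from from∘to , x~y
    where
    f : Fin k ⊎ Fin k → Fin n
    f = [ x , y ]′

    f-injective : ∀ p q → f p ≡ f q → p ≡ q
    f-injective (inj₁ i) (inj₁ i′) xi≡xi′ = cong inj₁
      (Equivalence.to (x~y i i′)
        (subst (λ u → Adj G u (y i′)) (sym xi≡xi′) (Equivalence.from (x~y i′ i′) refl)))
    f-injective (inj₁ i) (inj₂ j) xi≡yj = contradiction xi≡yj (x≢y i j)
    f-injective (inj₂ j) (inj₁ i) yj≡xi = contradiction (sym yj≡xi) (x≢y i j)
    f-injective (inj₂ j) (inj₂ j′) yj≡yj′ = cong inj₂
      (Equivalence.to (x~y j j′)
        (subst (Adj G (x j)) yj≡yj′ (Equivalence.from (x~y j j) refl)))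

    image? : Decidable (λ v → ∃[ p ] f p ≡ v)
    image? v = map′
      (λ { (inj₁ (i , e)) → inj₁ i , e ; (inj₂ (j , e)) → inj₂ j , e })
      (λ { (inj₁ i , e) → inj₁ (i , e) ; (inj₂ j , e) → inj₂ (j , e) })
      (Fin.any? (λ i → x i Fin.≟ v) ⊎-dec Fin.any? (λ j → y j Fin.≟ v))

    S : Subset n
    S = satisfying image?

    to : Fin k ⊎ Fin k → ∃[ v ] v ∈ S
    to p = f p , ∈-satisfying⁺ image? (p , refl)

    from : ∃[ v ] v ∈ S → Fin k ⊎ Fin k
    from (v , v∈S) = proj₁ (∈-satisfying⁻ image? v∈S)

    ≡-vertex : ∀ {u v} {u∈S : u ∈ S} {v∈S : v ∈ S} → u ≡ v → (u , u∈S) ≡ (v , v∈S)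
    ≡-vertex refl = cong (_ ,_) (∈-irrelevant _ _)

    to∘from : ∀ w → to (from w) ≡ w
    to∘from (v , v∈S) = ≡-vertex (proj₂ (∈-satisfying⁻ image? v∈S))

    from∘to : ∀ p → from (to p) ≡ p
    from∘to p = f-injective _ _ (proj₂ (∈-satisfying⁻ image? (proj₂ (to p))))

  Dominates : Subset n → ∀ {l} → (Fin l → Fin n) → Set
  Dominates C x = ∀ c → c ∈ C → ∃[ i ] Adj G (x i) c

  dominates? : ∀ C {l} (x : Fin l → Fin n) → Dec (Dominates C x)
  dominates? C x = Fin.all? (λ c → (c ∈? C) →-dec Fin.any? (λ i → T? (adj G (x i) c)))

  -- Some vertex of `C` is missed when entry `i` is dropped, yet the whole tuple dominates it, so
  -- entry `i` alone can be adjacent to it.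
  private-neighbour : ∀ C {l} (x : Fin (suc l) → Fin n) → Dominates C x →
    ∀ i → ¬ Dominates C (x ∘ punchIn i) →
    ∃[ c ] (c ∈ C × (∀ j → Adj G (x j) c ⇔ j ≡ i))
  private-neighbour C x dom i ¬dom =
    c , c∈C , λ j → mk⇔ (only j) λ { refl → subst (λ j → Adj G (x j) c) (only _ x~c) x~c }
    where
    undominated = Fin.¬∀⟶∃¬ n _
      (λ c → (c ∈? C) →-dec Fin.any? (λ j → T? (adj G (x (punchIn i j)) c))) ¬dom
    c = proj₁ undominated
    c∈C : c ∈ C
    c∈C = decidable-stable (c ∈? C) (λ c∉C → proj₂ undominated (λ c∈C → contradiction c∈C c∉C))
    x~c = proj₂ (dom c c∈C)
    only : ∀ j → Adj G (x j) c → j ≡ i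
    only j xj~c with i Fin.≟ j
    ... | yes i≡j = sym i≡j
    ... | no  i≢j = contradiction
      (λ _ → punchOut i≢j , subst (λ j → Adj G (x j) c) (sym (Fin.punchIn-punchOut i≢j)) xj~c)
      (proj₂ undominated)

  -- A minimal dominating tuple has private neighbours, so if it were longer than
  -- m it would induce an immature (m + 1)-creature with some of them.
  few-dominators : ∀ {m} → ImmatureCreatureFree (suc m) G → ∀ C l (x : Fin l → Fin n) →
    (∀ i → x i ∉ C) → Dominates C x →
    ∃[ l′ ] (l′ ≤ m × ∃[ x′ ] ((∀ (i : Fin l′) → ∃[ j ] x′ i ≡ x j) × Dominates C x′))
  few-dominators {m} free C l x x∉C dom with l ≤? m
  ... | yes l≤m = l , l≤m , x , (λ i → i , refl) , dom
  few-dominators free C zero    x x∉C dom | no l≰m = contradiction z≤n l≰m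
  few-dominators {m} free C (suc l) x x∉C dom | no l≰m
    with Fin.any? (λ i → dominates? C (x ∘ punchIn i))
  ... | yes (i , dom′) with few-dominators free C l (x ∘ punchIn i) (x∉C ∘ punchIn i) dom′
  ...   | l′ , l′≤m , x′ , from , dom″ =
    l′ , l′≤m , x′ , (λ j → _ , proj₂ (from j)) , dom″
  few-dominators {m} free C (suc l) x x∉C dom | no l≰m | no ¬shrinks =
    contradiction (proj₂ K) (free (proj₁ K))
    where
    ι : Fin (suc m) → Fin (suc l)
    ι i = inject≤ i (≰⇒> l≰m)
    private-nbr = λ i → private-neighbour C x dom (ι i) (λ d → ¬shrinks (ι i , d))
    -- The sides are disjoint because the entries of `x` avoid `C` while their private neighbours
    -- lie in `C`.
    K = creature (x ∘ ι) (λ i → proj₁ (private-nbr i))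
      (λ i j x≡y → x∉C (ι i) (subst (_∈ C) (sym x≡y) (proj₁ (proj₂ (private-nbr j)))))
      (λ i j → mk⇔
        (λ xi~yj → Fin.inject≤-injective _ _ i j (Equivalence.to (proj₂ (proj₂ (private-nbr j)) (ι i)) xi~yj))
        (λ { refl → Equivalence.from (proj₂ (proj₂ (private-nbr j)) (ι i)) refl }))

  Reachable-sym : ∀ {C u v} → Reachable G C u v → Reachable G C v u
  Reachable-sym = reverse (λ (u∉ , v∉ , u~v) → v∉ , u∉ , Adj-sym u~v)

  Reachable-∉ : ∀ {C u v} → u ∉ C → Reachable G C u v → v ∉ C
  Reachable-∉ u∉C ε                    = u∉C
  Reachable-∉ u∉C ((_ , w∉C , _) ◅ r) = Reachable-∉ w∉C r

  Reachable-snoc : ∀ {C u v w} → u ∉ C → Reachable G C u v → Adj G v w → w ∉ C → Reachable G C u w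
  Reachable-snoc u∉C r v~w w∉C = r ◅◅ ((Reachable-∉ u∉C r , w∉C , v~w) ◅ ε)

  components-disjoint : ∀ {C L R v} → IsComponent G C L → IsComponent G C R →
    v ∈ L → v ∈ R → L ≡ R
  components-disjoint {C} (a , _ , L⊆ , L⊇) (b , _ , R⊆ , R⊇) v∈L v∈R =
    ⊆-antisym (λ u∈L → R⊇ (b⟶a ◅◅ L⊆ u∈L))
              (λ u∈R → L⊇ (Reachable-sym {C} b⟶a ◅◅ R⊆ u∈R))
    where b⟶a = R⊆ v∈R ◅◅ Reachable-sym {C} (L⊆ v∈L)

  -- Shrinking starts from all vertices of `L`, listed as an n-tuple in which `a` stands in for each
  -- vertex outside `L`. The short tuple is then padded with `a` to a function on ℕ. So its length
  -- need not be tracked, and entry 0 is a vertex of `L` even if `C` is empty and nothing has to be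
  -- dominated.
  component-dominators : ∀ {m} → ImmatureCreatureFree (suc m) G → ∀ {C L} →
    IsComponent G C L → (∀ c → c ∈ C → ∃[ v ] (v ∈ L × Adj G v c)) →
    ∃[ x ] ((∀ i → x i ∈ L) × (∀ c → c ∈ C → ∃[ i ] (i < m × Adj G (x i) c)))
  component-dominators {m} free {C} {L} (a , a∉C , L⊆ , L⊇) full = pad , pad∈L , pad-dom
    where
    clamp : Fin n → Fin n
    clamp v with v ∈? L
    ... | yes _ = v
    ... | no  _ = a
    clamp∈L : ∀ v → clamp v ∈ L
    clamp∈L v with v ∈? L
    ... | yes v∈L = v∈L
    ... | no  _   = L⊇ ε
    clamp-∈ : ∀ {v} → v ∈ L → clamp v ≡ v
    clamp-∈ {v} v∈L with v ∈? L
    ... | yes _   = refl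
    ... | no  v∉L = contradiction v∈L v∉L
    few = few-dominators free C n clamp (λ v → Reachable-∉ a∉C (L⊆ (clamp∈L v)))
      (λ c c∈C → let v , v∈L , v~c = full c c∈C in
        v , subst (λ u → Adj G u c) (sym (clamp-∈ v∈L)) v~c)
    l = proj₁ few
    x = proj₁ (proj₂ (proj₂ few))
    x∈L : ∀ i → x i ∈ L
    x∈L i = let j , x≡ = proj₁ (proj₂ (proj₂ (proj₂ few))) i in subst (_∈ L) (sym x≡) (clamp∈L j)
    pad : ℕ → Fin n
    pad i with i <? l
    ... | yes i<l = x (fromℕ< i<l)
    ... | no  _   = a
    pad∈L : ∀ i → pad i ∈ L
    pad∈L i with i <? l
    ... | yes i<l = x∈L (fromℕ< i<l)
    ... | no  _   = L⊇ ε
    pad-toℕ : ∀ i → pad (toℕ i) ≡ x i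
    pad-toℕ i with toℕ i <? l
    ... | yes i<l = cong x (Fin.fromℕ<-toℕ i i<l)
    ... | no  i≮l = contradiction (Fin.toℕ<n i) i≮l
    pad-dom : ∀ c → c ∈ C → ∃[ i ] (i < m × Adj G (pad i) c)
    pad-dom c c∈C = let i , x~c = proj₂ (proj₂ (proj₂ (proj₂ few))) c c∈C in
      toℕ i , <-≤-trans (Fin.toℕ<n i) (proj₁ (proj₂ few))
        , subst (λ u → Adj G u c) (sym (pad-toℕ i)) x~c

  -- Fullness of the component of `v`, phrased through walks from `v` instead of a named vertex set;
  -- this is what a search from `v` can test.
  FullFrom : Subset n → Fin n → Set
  FullFrom C v = v ∉ C × (∀ c → c ∈ C → ∃[ u ] (Reachable G C v u × Adj G u c))

  Separates : Subset n → Fin n → Fin n → Set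
  Separates C u v = FullFrom C u × FullFrom C v × ¬ Reachable G C u v

  -- `L` and `R` are left to the caller because a component must be given as a `Subset`: the vertex
  -- sets visited by the two searches are inserted here. A neighbour of a component that avoided `C`
  -- would belong to the component itself, so its neighbourhood is within `C`.
  separates⇒minimal : ∀ {C u v L R} → Separates C u v →
    (u ∉ C → (_∈ L) ≐ Reachable G C u) → (v ∉ C → (_∈ R) ≐ Reachable G C v) →
    IsMinimalSeparator G C
  separates⇒minimal {C} {u} {v} {L} {R} (fullᵤ , fullᵥ , u≁v) compᵤ compᵥ =
    L , R , (u , u∉C , L≐) , (v , v∉C , R≐)
      , (λ L≡R → u≁v (proj₁ L≐ (subst (v ∈_) (sym L≡R) (proj₂ R≐ ε))))
      , neighbourhood fullᵤ L≐ , neighbourhood fullᵥ R≐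
    where
    u∉C = proj₁ fullᵤ
    v∉C = proj₁ fullᵥ
    L≐ = compᵤ u∉C
    R≐ = compᵥ v∉C
    neighbourhood : ∀ {w K} → FullFrom C w → (_∈ K) ≐ Reachable G C w → N G K ≐ (_∈ C)
    neighbourhood (w∉C , full) (K⊆ , K⊇) =
      (λ { {c} (c∉K , a , a∈K , c~a) → decidable-stable (c ∈? C) (λ c∉C →
           c∉K (K⊇ (Reachable-snoc w∉C (K⊆ a∈K) (Adj-sym c~a) c∉C))) })
      , λ {c} c∈C → let a , w⟶a , a~c = full c c∈C in
          (λ c∈K → Reachable-∉ w∉C (K⊆ c∈K) c∈C) , a , K⊇ w⟶a , Adj-sym a~c

  component⇒full : ∀ {C L v} → IsComponent G C L → N G L ≐ (_∈ C) → v ∈ L → FullFrom C v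
  component⇒full (a , a∉C , L⊆ , L⊇) (_ , C⊆N) v∈L =
    Reachable-∉ a∉C (L⊆ v∈L) ,
    λ c c∈C → let _ , u , u∈L , c~u = C⊆N c∈C in
      u , Reachable-sym (L⊆ v∈L) ◅◅ L⊆ u∈L , Adj-sym c~u

  adjacent : ℕ → (ℕ → Fin n) → Fin n → Bool
  adjacent zero    x v = false
  adjacent (suc m) x v = adj G (x m) v ∨ adjacent m x v

  adjacent⁺ : ∀ m x v {i} → i < m → Adj G (x i) v → adjacent m x v ≡ true
  adjacent⁺ (suc m) x v {i} i<1+m xi~v with adj G (x m) v in xm~v
  ... | true  = refl
  ... | false with m≤n⇒m<n∨m≡n (s≤s⁻¹ i<1+m)
  ...   | inj₁ i<m  = adjacent⁺ m x v i<m xi~v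
  ...   | inj₂ refl = ⊥-elim (subst T xm~v xi~v)

  adjacent⁻ : ∀ m x v → adjacent m x v ≡ true → ∃[ i ] (i < m × Adj G (x i) v)
  adjacent⁻ (suc m) x v adj≡ with adj G (x m) v in xm~v
  ... | true  = m , ≤-refl , subst T (sym xm~v) tt
  ... | false = let i , i<m , xi~v = adjacent⁻ m x v adj≡ in i , m<n⇒m<1+n i<m , xi~v

  cut : ℕ → (ℕ → Fin n) → Subset n
  cut m t = tabulate (λ v → adjacent m t v ∧ adjacent m (λ i → t (i + m)) v)

  -- No neighbour of one component of G ∖ C is a vertex of another one, so the
  -- common neighbours of dominating sets from the two components are all in C.
  minimal⇒cut : ∀ {m} → ImmatureCreatureFree (suc (suc m)) G → ∀ {C} → IsMinimalSeparator G C →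
    ∃[ t ] (cut (suc m) t ≡ C × Separates C (t 0) (t (suc m)))
  minimal⇒cut {m} free {C} (L , R , cL , cR , L≢R , NL , NR) =
    t , cut≡C , subst₂ (Separates C) (sym (t-left z<s)) (sym (t-right 0))
          (component⇒full cL NL (x∈L 0) , component⇒full cR NR (y∈R 0) , x≁y)
    where
    side : ∀ {K} → IsComponent G C K → N G K ≐ (_∈ C) → _
    side {K} cK NK = component-dominators free cK
      (λ c c∈C → let _ , v , v∈K , c~v = proj₂ NK c∈C in v , v∈K , Adj-sym c~v)
    x = proj₁ (side cL NL)
    y = proj₁ (side cR NR)
    x∈L = proj₁ (proj₂ (side cL NL))
    y∈R = proj₁ (proj₂ (side cR NR))
    x-dom = proj₂ (proj₂ (side cL NL))
    y-dom = proj₂ (proj₂ (side cR NR))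
    t : ℕ → Fin n
    t i with i <? suc m
    ... | yes _ = x i
    ... | no  _ = y (i ∸ suc m)
    t-left : ∀ {i} → i < suc m → t i ≡ x i
    t-left {i} i<m with i <? suc m
    ... | yes _   = refl
    ... | no  i≮m = contradiction i<m i≮m
    t-right : ∀ i → t (i + suc m) ≡ y i
    t-right i with i + suc m <? suc m
    ... | yes i+m<m = contradiction i+m<m (m+n≮n i (suc m))
    ... | no  _     = cong y (m+n∸n≡m i (suc m))
    x≁y : ¬ Reachable G C (x 0) (y 0)
    x≁y r = let _ , _ , L⊆ , L⊇ = cL in
      L≢R (components-disjoint cL cR (L⊇ (L⊆ (x∈L 0) ◅◅ r)) (y∈R 0))
    beyond : ∀ {K u v} → IsComponent G C K → u ∈ K → Adj G u v → v ∉ C → v ∈ K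
    beyond (a , a∉C , K⊆ , K⊇) u∈K u~v v∉C = K⊇ (Reachable-snoc a∉C (K⊆ u∈K) u~v v∉C)
    inside : ∀ v → v ∈ C → adjacent (suc m) t v ∧ adjacent (suc m) (λ i → t (i + suc m)) v ≡ true
    inside v v∈C = let i , i<m , xi~v = x-dom v v∈C ; j , j<m , yj~v = y-dom v v∈C in
      cong₂ _∧_
        (adjacent⁺ (suc m) t v i<m (subst (λ u → Adj G u v) (sym (t-left i<m)) xi~v))
        (adjacent⁺ (suc m) _ v j<m (subst (λ u → Adj G u v) (sym (t-right j)) yj~v))
    outside : ∀ v → adjacent (suc m) t v ∧ adjacent (suc m) (λ i → t (i + suc m)) v ≡ true → v ∈ C
    outside v both = decidable-stable (v ∈? C) λ v∉C →
      let l , r = ∧-≡true both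
          i , i<m , ti~v = adjacent⁻ (suc m) t v l
          j , j<m , tj~v = adjacent⁻ (suc m) _ v r
      in L≢R (components-disjoint cL cR
           (beyond cL (x∈L i) (subst (λ u → Adj G u v) (t-left i<m) ti~v) v∉C)
           (beyond cR (y∈R j) (subst (λ u → Adj G u v) (t-right j) tj~v) v∉C))
      where
      ∧-≡true : ∀ {a b} → a ∧ b ≡ true → a ≡ true × b ≡ true
      ∧-≡true {true} {true} _ = refl , refl
    cut≡C : cut (suc m) t ≡ C
    cut≡C = ⊆-antisym
      (λ {v} v∈cut → outside v (trans (sym (lookup∘tabulate _ v)) (∈⇒lookup v∈cut)))
      (λ {v} v∈C → lookup⇒∈ (trans (lookup∘tabulate _ v) (inside v v∈C)))

-- The enumeration algorithm

notE : Exp → Exp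
notE e = eq e (lit 0)

-- On bits, a < b holds only for a = 0 and b = 1, so a comparison whose first argument is negated is
-- a conjunction.
andE orE : Exp → Exp → Exp
andE e f = lt (notE e) f
orE e f  = notE (andE (notE e) (notE f))

row col round sep vis done cur ok hit next node mark : ℕ
row = 0
col = 1
round = 2
sep = 3
vis = 4
done = 5
cur = 6
ok = 7
hit = 8
next = 12
node = 13
mark = 14

-- The separators found so far are kept in a binary trie: the child of node j
-- along the edge b is in cell j of the array  child b.  The root is node 1, and 0
-- stands for a missing node; next is the least number not yet used for a node.
child : Bool → ℕ
child false = 10
child true  = 11

-- All other arrays have numbers below 20, so their distinctness from `tuple j` holds by computation
-- even for a variable `j`.
tuple : ℕ → ℕ
tuple j = 20 + j

var : ℕ → Exp
var x = x ! lit 0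

fill : ℕ → ℕ → Exp → Prog
fill x a e = for x (asg a (var x) e)

-- Unrolled over the entries, so that the cost depends on the length of the tuple alone and no loop
-- is added.
adjacentE : ℕ → (ℕ → ℕ) → Exp
adjacentE zero    a = lit 0
adjacentE (suc m) a = orE (edge (var (a m)) (var row)) (adjacentE m a)

cutP : ℕ → Prog
cutP m = fill row sep (andE (adjacentE m tuple) (adjacentE m (λ i → tuple (i + m))))

reachedE : Exp
reachedE = orE (vis ! var col) (andE (notE (sep ! var col)) (edge (var cur) (var col)))

-- After select, cur holds a visited vertex that is not yet processed, or
-- the order of the graph if there is none: then edge reads 0 and expand does
-- nothing.  So all rounds have the same shape, and n of them suffice.
select expand : Prog
select = asg cur (lit 0) order ▸
  for col (cond (andE (vis ! var col) (notE (done ! var col))) (asg cur (lit 0) (var col)) nop)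
expand = fill col vis reachedE ▸ asg done (var cur) (lit 1)

search : ℕ → Prog
search a =
  fill row vis (andE (eq (var row) (var a)) (notE (sep ! var row))) ▸
  fill row done (lit 0) ▸
  for round (select ▸ expand)

conj : Exp → Prog
conj e = asg ok (lit 0) (andE (var ok) e)

hitP dominate : Prog
hitP =
  asg hit (lit 0) (lit 0) ▸
  for col (asg hit (lit 0) (orE (var hit) (andE (vis ! var col) (edge (var col) (var row)))))
dominate = for row (hitP ▸ conj (orE (notE (sep ! var row)) (var hit)))

-- The search visits its start vertex exactly when that vertex is outside `sep`; the `conj` tests
-- this, and `dominate` tests fullness of the visited component.
check : ℕ → Prog
check a = search a ▸ conj (vis ! var a) ▸ dominate

-- The question whether the second start vertex lies in the first component is asked between the two
-- checks, before the second search overwrites `vis`.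
test : ℕ → Prog
test m =
  cutP m ▸ asg ok (lit 0) (lit 1) ▸
  check (tuple 0) ▸ conj (notE (vis ! var (tuple m))) ▸ check (tuple m)

descend : ℕ → Prog
descend a =
  cond (a ! var node) nop
    (asg a (var node) (var next) ▸ asg next (lit 0) (inc (var next))) ▸
  asg node (lit 0) (a ! var node)

insert : Prog
insert =
  asg node (lit 0) (lit 1) ▸
  for row (cond (sep ! var row) (descend (child true)) (descend (child false)))

-- Insertion creates missing nodes in any case, so the existence of the leaf afterwards says
-- nothing; `mark` remembers whether its set has been printed.
emit : Prog
emit =
  insert ▸
  cond (mark ! var node) nop
    (asg mark (var node) (lit 1) ▸ for row (prt (sep ! var row)))

core : ℕ → Prog
core m = test m ▸ cond (var ok) emit nop

nest : ℕ → Prog → Prog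
nest zero    p = p
nest (suc j) p = for (tuple j) (nest j p)

algorithm : ℕ → Prog
algorithm m = asg next (lit 0) (lit 2) ▸ nest (m + m) (core m)

fresh-nest : ∀ p → (∀ i → Fresh (tuple i) p) → ∀ j i → j ≤ i → Fresh (tuple i) (nest j p)
fresh-nest p fresh zero    i _   = fresh i
fresh-nest p fresh (suc j) i j<i =
  ≢⇒not (λ i≡j → <⇒≢ j<i (sym i≡j)) , fresh-nest p fresh j i (<⇒≤ j<i)

wellFormed-nest : ∀ p → (∀ i → Fresh (tuple i) p) → WellFormed p → ∀ j → WellFormed (nest j p)
wellFormed-nest p fresh wf zero    = wf
wellFormed-nest p fresh wf (suc j) = fresh-nest p fresh j j ≤-refl , wellFormed-nest p fresh wf j

depth-nest : ∀ p j → depth (nest j p) ≡ j + depth p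
depth-nest p zero    = refl
depth-nest p (suc j) = cong suc (depth-nest p j)

-- A proof contains a decision of `P` besides the claim that `x` is its bit. Specifications in this
-- form therefore decide the properties that the program tests, such as `Separates`.
Holds : ℕ → Set → Set
Holds x P = ∃[ d ] x ≡ bit (does {A = P} d)

holds-map : ∀ {x P Q} → (P → Q) → (Q → P) → Holds x P → Holds x Q
holds-map f g (d , x≡) = map′ f g d , x≡

holds-cong : ∀ {x y P} → x ≡ y → Holds y P → Holds x P
holds-cong x≡y (d , y≡) = d , trans x≡y y≡

-- Correctness of the algorithm

record Trie (A : Bool → ℕ → ℕ) (M : ℕ) : Set where
  field
    dead      : ∀ b → A b 0 ≡ 0
    bounded   : ∀ b j → A b j < M
    nonroot   : ∀ b j → A b j ≢ 1
    injective : ∀ {b b′ j j′} → A b j ≢ 0 → A b j ≡ A b′ j′ → b ≡ b′ × j ≡ j′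
    2≤M       : 2 ≤ M

open Trie

-- Node 0 has only itself as a child, so a walk that has left the trie stays at 0, and a walk ending
-- at a nonzero node has been in the trie throughout.
walk : (Bool → ℕ → ℕ) → (ℕ → Bool) → ℕ → ℕ
walk A f zero    = 1
walk A f (suc i) = A (f i) (walk A f i)

infix 4 _⊑_

_⊑_ : (A A′ : Bool → ℕ → ℕ) → Set
A ⊑ A′ = ∀ b j → A b j ≢ 0 → A′ b j ≡ A b j

⊑-trans : ∀ {A B C} → A ⊑ B → B ⊑ C → A ⊑ C
⊑-trans A⊑B B⊑C b j A≢0 =
  trans (B⊑C b j (λ B≡0 → A≢0 (trans (sym (A⊑B b j A≢0)) B≡0))) (A⊑B b j A≢0)

trie-cong : ∀ {A A′ M M′} → (∀ b j → A′ b j ≡ A b j) → M′ ≡ M → Trie A M → Trie A′ M′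
trie-cong eqA refl t = record
  { dead      = λ b → trans (eqA b 0) (dead t b)
  ; bounded   = λ b j → subst (_< _) (sym (eqA b j)) (bounded t b j)
  ; nonroot   = λ b j A′≡1 → nonroot t b j (trans (sym (eqA b j)) A′≡1)
  ; injective = λ {b} {b′} {j} {j′} A′≢0 e →
      injective t (λ A≡0 → A′≢0 (trans (eqA b j) A≡0)) (trans (sym (eqA b j)) (trans e (eqA b′ j′)))
  ; 2≤M       = 2≤M t }

walk-cong : ∀ {A A′} → (∀ b j → A′ b j ≡ A b j) → ∀ f i → walk A′ f i ≡ walk A f i
walk-cong eqA f zero    = refl
walk-cong {A} {A′} eqA f (suc i) = trans (eqA (f i) _) (cong (A (f i)) (walk-cong eqA f i))

walk-alive : ∀ {A M} → Trie A M → ∀ f i → walk A f (suc i) ≢ 0 → walk A f i ≢ 0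
walk-alive {A} t f i w≢0 w≡0 = w≢0 (trans (cong (A (f i)) w≡0) (dead t (f i)))

walk-⊑ : ∀ {A A′ M} → Trie A M → A ⊑ A′ → ∀ f i → walk A f i ≢ 0 → walk A′ f i ≡ walk A f i
walk-⊑ t A⊑A′ f zero    _   = refl
walk-⊑ {A} {A′} t A⊑A′ f (suc i) w≢0 =
  trans (cong (A′ (f i)) (walk-⊑ t A⊑A′ f i (walk-alive t f i w≢0))) (A⊑A′ (f i) _ w≢0)

-- A nonzero node determines its parent and the bit on the edge to it. Going back step by step, two
-- walks of equal length to the same node have read the same bits; hence a leaf identifies its set.
walk-injective : ∀ {A M} → Trie A M → ∀ f g i → walk A f i ≢ 0 → walk A f i ≡ walk A g i →
                 ∀ {j} → j < i → f j ≡ g j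
walk-injective t f g (suc i) w≢0 w≡ {j} j<1+i with injective t w≢0 w≡ | m≤n⇒m<n∨m≡n (s≤s⁻¹ j<1+i)
... | fi≡gi , _  | inj₂ refl = fi≡gi
... | _     , w≡′ | inj₁ j<i  = walk-injective t f g i (walk-alive t f i w≢0) w≡′ j<i

-- All old targets are below `M`, so the one new edge, which leads to `M`, cannot share its target
-- with an old edge.
trie-extend : ∀ {A A′ M} b v → Trie A M → v ≢ 0 → A′ b v ≡ M →
  (∀ b′ j → (b′ ≡ b × j ≡ v) ⊎ A′ b′ j ≡ A b′ j) → Trie A′ (suc M)
trie-extend {A} {A′} {M} b v t v≢0 new other = record
  { dead = dead′ ; bounded = bounded′ ; nonroot = nonroot′ ; injective = injective′
  ; 2≤M = m≤n⇒m≤1+n (2≤M t) }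
  where
  dead′ : ∀ b′ → A′ b′ 0 ≡ 0
  dead′ b′ with other b′ 0
  ... | inj₁ (_ , 0≡v) = contradiction (sym 0≡v) v≢0
  ... | inj₂ old       = trans old (dead t b′)
  bounded′ : ∀ b′ j → A′ b′ j < suc M
  bounded′ b′ j with other b′ j
  ... | inj₁ (refl , refl) = s≤s (≤-reflexive new)
  ... | inj₂ old           = m<n⇒m<1+n (subst (_< M) (sym old) (bounded t b′ j))
  nonroot′ : ∀ b′ j → A′ b′ j ≢ 1
  nonroot′ b′ j A′≡1 with other b′ j
  ... | inj₁ (refl , refl) = <⇒≢ (2≤M t) (trans (sym A′≡1) new)
  ... | inj₂ old           = nonroot t b′ j (trans (sym old) A′≡1)
  injective′ : ∀ {b₁ b₂ j₁ j₂} → A′ b₁ j₁ ≢ 0 → A′ b₁ j₁ ≡ A′ b₂ j₂ → b₁ ≡ b₂ × j₁ ≡ j₂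
  injective′ {b₁} {b₂} {j₁} {j₂} A′≢0 e with other b₁ j₁ | other b₂ j₂
  ... | inj₁ (refl , refl) | inj₁ (refl , refl) = refl , refl
  ... | inj₁ (refl , refl) | inj₂ old =
    contradiction (trans (sym old) (trans (sym e) new)) (<⇒≢ (bounded t b₂ j₂))
  ... | inj₂ old | inj₁ (refl , refl) =
    contradiction (trans (sym old) (trans e new)) (<⇒≢ (bounded t b₁ j₁))
  ... | inj₂ old₁ | inj₂ old₂ =
    injective t (λ A≡0 → A′≢0 (trans old₁ A≡0)) (trans (sym old₁) (trans e old₂))

kids : Store → Bool → ℕ → ℕ
kids s b = s (child b)

-- Truth values in the store and the graph search

module Evaluation {n : ℕ} (G : FinGraph n) where

  open Semantics G
  open GraphProperties G

  holds-not : ∀ {s P} e → Holds (eval G s e) P → Holds (eval G s (notE e)) (¬ P)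
  holds-not {s} e (d , e≡) = ¬? d , trans (cong (λ x → bit (x ≡ᵇ 0)) e≡) (lemma (does d))
    where
    lemma : ∀ b → bit (bit b ≡ᵇ 0) ≡ bit (not b)
    lemma false = refl
    lemma true  = refl

  holds-and : ∀ {s P Q} e f → Holds (eval G s e) P → Holds (eval G s f) Q →
              Holds (eval G s (andE e f)) (P × Q)
  holds-and {s} e f (d , e≡) (d′ , f≡) =
    (d ×-dec d′) , trans (cong₂ (λ x y → bit (bit (x ≡ᵇ 0) <ᵇ y)) e≡ f≡) (lemma (does d) (does d′))
    where
    lemma : ∀ a b → bit (bit (bit a ≡ᵇ 0) <ᵇ bit b) ≡ bit (a ∧ b)
    lemma false false = refl
    lemma false true  = refl
    lemma true  false = refl
    lemma true  true  = refl

  holds-or : ∀ {s P Q} e f → Holds (eval G s e) P → Holds (eval G s f) Q →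
             Holds (eval G s (orE e f)) (P ⊎ Q)
  holds-or {s} e f (d , e≡) (d′ , f≡) =
    (d ⊎-dec d′) , trans
      (cong₂ (λ x y → bit (bit (bit (bit (x ≡ᵇ 0) ≡ᵇ 0) <ᵇ bit (y ≡ᵇ 0)) ≡ᵇ 0)) e≡ f≡)
      (lemma (does d) (does d′))
    where
    lemma : ∀ a b → bit (bit (bit (bit (bit a ≡ᵇ 0) ≡ᵇ 0) <ᵇ bit (bit b ≡ᵇ 0)) ≡ᵇ 0) ≡ bit (a ∨ b)
    lemma false false = refl
    lemma false true  = refl
    lemma true  false = refl
    lemma true  true  = refl

  edgeBit-toℕ : ∀ u v → edgeBit G (toℕ u) (toℕ v) ≡ bit (adj G u v)
  edgeBit-toℕ u v with toℕ u <? n | toℕ v <? n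
  ... | yes u<n | yes v<n = cong₂ (λ u v → bit (adj G u v)) (Fin.fromℕ<-toℕ u u<n) (Fin.fromℕ<-toℕ v v<n)
  ... | no u≮n  | _       = contradiction (Fin.toℕ<n u) u≮n
  ... | yes _   | no v≮n  = contradiction (Fin.toℕ<n v) v≮n

  edgeBit-outside : ∀ j → edgeBit G n j ≡ 0
  edgeBit-outside j with n <? n | j <? n
  ... | yes n<n | _ = contradiction n<n (n≮n n)
  ... | no _    | _ = refl

  holds-edge : ∀ {x y} u v → x ≡ toℕ u → y ≡ toℕ v → Holds (edgeBit G x y) (Adj G u v)
  holds-edge u v refl refl = T? (adj G u v) , edgeBit-toℕ u v

  holds-≡ : ∀ {x y} (u v : Fin n) → x ≡ toℕ u → y ≡ toℕ v → Holds (bit (x ≡ᵇ y)) (u ≡ v)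
  holds-≡ u v refl refl = map′ Fin.toℕ-injective (cong toℕ) (toℕ u ≟ toℕ v) , refl

  -- A write to another array vanishes by computation when both array numbers are numerals. This is
  -- why `mkBits (bits B)` carries a fact over to the updated store.
  record Bits (s : Store) (a : ℕ) (S : Subset n) : Set where
    constructor mkBits
    field bits : ∀ v → Holds (s a (toℕ v)) (v ∈ S)

  open Bits

  bits-frame : ∀ p s {a S} → Fresh a p → Bits s a S → Bits (run p s) a S
  bits (bits-frame p s fr B) v = holds-cong (frame p fr s _) (bits B v)

  bits-at : ∀ {s a S x} → Bits s a S → ∀ v → x ≡ toℕ v → Holds (s a x) (v ∈ S)
  bits-at B v refl = bits B v

  -- Cells are written in increasing order, so at the moment of writing cell v that cell still has
  -- its original value. Thus `e` may read the cell it overwrites, as `reachedE` does.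
  fill-spec : ∀ x a e → T (not (a ≡ᵇ x)) → T (not (x ≡ᵇ a)) → ∀ {s} (Q : Fin n → ℕ → Set) →
    (∀ v {s′} → s′ x 0 ≡ toℕ v → s′ a (toℕ v) ≡ s a (toℕ v) →
       (∀ {b} j → T (not (b ≡ᵇ x)) → T (not (b ≡ᵇ a)) → s′ b j ≡ s b j) → Q v (eval G s′ e)) →
    ∀ v → Q v (run (fill x a e) s a (toℕ v))
  fill-spec x a e a≢x x≢a {s} Q value v =
    proj₁ (for-invariant x (asg a (var x) e) I {s} x≢a base step) v (Fin.toℕ<n v)
    where
    I : ℕ → Store → Set
    I i s′ = (∀ v → toℕ v < i → Q v (s′ a (toℕ v)))
           × (∀ v → i ≤ toℕ v → s′ a (toℕ v) ≡ s a (toℕ v))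
           × (∀ {b} j → T (not (b ≡ᵇ x)) → T (not (b ≡ᵇ a)) → s′ b j ≡ s b j)
    base : I 0 (s [ x , 0 ↦ 0 ])
    base = (λ _ ()) , (λ v _ → update-other s x 0 0 _ a≢x) , (λ j b≢x _ → update-other s x 0 0 j b≢x)
    step : ∀ w {s′} → s′ x 0 ≡ toℕ w → I (toℕ w) s′ → I (suc (toℕ w)) (tick x (run (asg a (var x) e) s′))
    step w {s′} x≡w (before , after , rest) =
        (λ u u≤w → subst (Q u) (sym (update-other s″ x 0 _ (toℕ u) a≢x)) (filled u u≤w))
      , (λ u w<u → trans (trans (update-other s″ x 0 _ (toℕ u) a≢x)
           (update-index s′ a _ _ (λ u≡x → <⇒≢ w<u (sym (trans u≡x x≡w))))) (after u (<⇒≤ w<u)))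
      , (λ j b≢x b≢a → trans (update-other s″ x 0 _ j b≢x)
           (trans (update-other s′ a _ _ j b≢a) (rest j b≢x b≢a)))
      where
      s″ = s′ [ a , s′ x 0 ↦ eval G s′ e ]
      filled : ∀ u → toℕ u < suc (toℕ w) → Q u (s″ a (toℕ u))
      filled u u≤w with m≤n⇒m<n∨m≡n (s≤s⁻¹ u≤w)
      ... | inj₁ u<w = subst (Q u)
        (sym (update-index s′ a _ _ (λ u≡x → <⇒≢ u<w (trans u≡x x≡w)))) (before u u<w)
      ... | inj₂ u≡w with Fin.toℕ-injective u≡w
      ...   | refl = subst (Q u)
        (sym (trans (cong (s″ a) (sym x≡w)) (update-same s′ a (s′ x 0) _)))
        (value u x≡w (after u ≤-refl) rest)

  cut-spec : ∀ m t {s} → (∀ i → i < m + m → s (tuple i) 0 ≡ toℕ (t i)) →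
             Bits (run (cutP m) s) sep (cut m t)
  bits (cut-spec m t {s} reads) v = holds-map
    (λ both → lookup⇒∈ (trans (lookup∘tabulate _ v) both))
    (λ v∈ → trans (sym (lookup∘tabulate _ v)) (∈⇒lookup v∈))
    (fill-spec row sep e _ _ {s}
      (λ v x → Holds x (adjacent m t v ∧ adjacent m (λ i → t (i + m)) v ≡ true))
      (λ v {s′} row≡ _ rest → holds-map ∧⁺ ∧⁻
        (holds-and {s′} (adjacentE m tuple) (adjacentE m (λ i → tuple (i + m)))
          (value m t tuple v row≡
            (λ i i<m → trans (rest 0 _ _) (reads i (m≤n⇒m≤n+o m i<m))))
          (value m (λ i → t (i + m)) (λ i → tuple (i + m)) v row≡
            (λ i i<m → trans (rest 0 _ _) (reads (i + m) (+-monoˡ-< m i<m))))))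
      v)
    where
    e = andE (adjacentE m tuple) (adjacentE m (λ i → tuple (i + m)))
    ∧⁺ : ∀ {a b} → a ≡ true × b ≡ true → a ∧ b ≡ true
    ∧⁺ (refl , refl) = refl
    ∧⁻ : ∀ {a b} → a ∧ b ≡ true → a ≡ true × b ≡ true
    ∧⁻ {true} {true} _ = refl , refl
    ∨⁺ : ∀ {a b} → T a ⊎ b ≡ true → a ∨ b ≡ true
    ∨⁺ {true}  _           = refl
    ∨⁺ {false} (inj₂ refl) = refl
    ∨⁻ : ∀ {a b} → a ∨ b ≡ true → T a ⊎ b ≡ true
    ∨⁻ {true}  _ = inj₁ tt
    ∨⁻ {false} p = inj₂ p
    value : ∀ k (u : ℕ → Fin n) (a : ℕ → ℕ) v {s′} → s′ row 0 ≡ toℕ v →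
      (∀ i → i < k → s′ (a i) 0 ≡ toℕ (u i)) →
      Holds (eval G s′ (adjacentE k a)) (adjacent k u v ≡ true)
    value zero    u a v row≡ reads = no (λ ()) , refl
    value (suc k) u a v {s′} row≡ reads = holds-map ∨⁺ ∨⁻
      (holds-or {s′} (edge (var (a k)) (var row)) (adjacentE k a)
        (holds-edge (u k) v (reads k ≤-refl) row≡)
        (value k u a v row≡ (λ i i<k → reads i (m<n⇒m<1+n i<k))))

  -- As long as some visited vertex is unprocessed each round processes a new one,
  -- which is what progress records.
  record Searching (Z : Subset n) (a : Fin n) (i : ℕ) (s : Store) : Set where
    field
      {visited processed} : Subset n
      sep-bits  : Bits s sep Z
      vis-bits  : Bits s vis visited
      done-bits : Bits s done processed
      start     : a ∉ Z → a ∈ visited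
      sound     : ∀ {v} → v ∈ visited → a ∉ Z × Reachable G Z a v
      closed    : ∀ {u v} → u ∈ processed → Adj G u v → v ∉ Z → v ∈ visited
      progress  : visited ⊆ processed ⊎ i ≤ ∣ processed ∣

  open Searching

  searching-round : ∀ {Z a i} s r → Searching Z a i s → Searching Z a i (s [ round , 0 ↦ r ])
  searching-round s r S = record
    { sep-bits  = mkBits (bits (sep-bits S))
    ; vis-bits  = mkBits (bits (vis-bits S))
    ; done-bits = mkBits (bits (done-bits S))
    ; start = start S ; sound = sound S ; closed = closed S ; progress = progress S }

  Selected : Subset n → Subset n → (ℕ → Set) → Store → Set
  Selected V D bound s =
    (∃[ u ] (s cur 0 ≡ toℕ u × u ∈ V × u ∉ D)) ⊎
    (s cur 0 ≡ n × (∀ u → bound (toℕ u) → u ∈ V → u ∈ D))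

  select-spec : ∀ {s V D} → Bits s vis V → Bits s done D →
                Selected V D (_< n) (run select s)
  select-spec {s} {V} {D} vis≐V done≐D =
    proj₁ (for-invariant col body
      (λ i s → Selected V D (_< i) s × Bits s vis V × Bits s done D) _
      (inj₂ (refl , λ _ ()) , mkBits (bits vis≐V) , mkBits (bits done≐D)) step)
    where
    body = cond (andE (vis ! var col) (notE (done ! var col))) (asg cur (lit 0) (var col)) nop
    step : ∀ v {s} → s col 0 ≡ toℕ v → Selected V D (_< toℕ v) s × Bits s vis V × Bits s done D →
           Selected V D (_< suc (toℕ v)) (tick col (run body s)) × Bits (tick col (run body s)) vis V
             × Bits (tick col (run body s)) done D
    step v {s} col≡ (sel , vis≐V , done≐D) =
      sel′ , mkBits (bits (bits-frame body s _ vis≐V)) , mkBits (bits (bits-frame body s _ done≐D))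
      where
      active = holds-and {s} (vis ! var col) (notE (done ! var col))
        (bits-at vis≐V v col≡) (holds-not {s} (done ! var col) (bits-at done≐D v col≡))
      sel′ : Selected V D (_< suc (toℕ v)) (tick col (run body s))
      sel′ with eval G s (andE (vis ! var col) (notE (done ! var col))) | active
      ... | _ | yes (v∈V , v∉D) , refl = inj₁ (v , col≡ , v∈V , v∉D)
      ... | _ | no ¬active , refl = [ inj₁ , (λ (cur≡n , none) → inj₂ (cur≡n , extend none)) ]′ sel
        where
        extend : (∀ u → toℕ u < toℕ v → u ∈ V → u ∈ D) → ∀ u → toℕ u < suc (toℕ v) → u ∈ V → u ∈ D
        extend none u u≤v u∈V with m≤n⇒m<n∨m≡n (s≤s⁻¹ u≤v)
        ... | inj₁ u<v = none u u<v u∈V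
        ... | inj₂ u≡v with Fin.toℕ-injective u≡v
        ...   | refl = decidable-stable (u ∈? D) (λ u∉D → ¬active (u∈V , u∉D))

  -- `P` abstracts the neighbourhood read through `cur`: that of the selected vertex in a real
  -- round, the empty one in an idle round. Both are instances.
  expand-vis : ∀ {s Z V} (P : Fin n → Set) → Bits s sep Z → Bits s vis V →
    (∀ v → Holds (edgeBit G (s cur 0) (toℕ v)) (P v)) →
    ∀ v → Holds (run expand s vis (toℕ v)) (v ∈ V ⊎ (v ∉ Z × P v))
  expand-vis {s} {Z} {V} P sep≐Z vis≐V edges =
    fill-spec col vis reachedE _ _ {s} (λ v x → Holds x (v ∈ V ⊎ (v ∉ Z × P v)))
      (λ v {s′} col≡ vis≡ rest →
        holds-or {s′} (vis ! var col) (andE (notE (sep ! var col)) (edge (var cur) (var col)))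
          (holds-cong (trans (cong (s′ vis) col≡) vis≡) (bits vis≐V v))
          (holds-and {s′} (notE (sep ! var col)) (edge (var cur) (var col))
            (holds-not {s′} (sep ! var col) (holds-cong (trans (cong (s′ sep) col≡) (rest _ _ _)) (bits sep≐Z v)))
            (holds-cong (cong₂ (edgeBit G) (rest 0 _ _) col≡) (edges v))))

  search-step : ∀ {Z a i s} → Searching Z a i s → Searching Z a (suc i) (run (select ▸ expand) s)
  search-step {Z} {a} {i} {s} S = go (select-spec (vis-bits S) (done-bits S))
    where
    V = visited S
    D = processed S
    s₁ = run select s
    s₂ = run (fill col vis reachedE) s₁
    sep₁ : Bits s₁ sep Z
    sep₁ = bits-frame select s _ (sep-bits S)
    vis₁ : Bits s₁ vis V
    vis₁ = bits-frame select s _ (vis-bits S)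
    done₁ : Bits s₁ done D
    done₁ = bits-frame select s _ (done-bits S)
    filled : ∀ {b} → T (not (b ≡ᵇ col)) → T (not (b ≡ᵇ vis)) → ∀ j → s₂ b j ≡ s₁ b j
    filled p q = frame (fill col vis reachedE) (p , q) s₁
    go : Selected V D (_< n) s₁ → Searching Z a (suc i) (run expand s₁)
    go (inj₂ (cur≡n , none)) = record
      { sep-bits  = bits-frame expand s₁ _ sep₁
      ; vis-bits  = mkBits λ v → holds-map [ (λ v∈V → v∈V) , (λ ()) ∘ proj₂ ]′ inj₁
          (expand-vis (λ _ → ⊥) sep₁ vis₁
            (λ v → no (λ ()) , trans (cong (λ x → edgeBit G x (toℕ v)) cur≡n) (edgeBit-outside _)) v)
      -- An idle round writes cell n of `done`, which belongs to no vertex.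
      ; done-bits = mkBits λ v → holds-cong
          (trans (update-index s₂ done _ 1 (λ v≡cur →
                   <⇒≢ (Fin.toℕ<n v) (trans v≡cur (trans (filled {cur} _ _ 0) cur≡n))))
                 (filled {done} _ _ _)) (bits done₁ v)
      ; start = start S ; sound = sound S ; closed = closed S
      ; progress = inj₁ (λ {u} → none u (Fin.toℕ<n u)) }
    go (inj₁ (u , cur≡u , u∈V , u∉D)) = record
      { sep-bits  = bits-frame expand s₁ _ sep₁
      ; vis-bits  = mkBits λ v → holds-map (∈-satisfying⁺ visit?) (∈-satisfying⁻ visit?)
          (expand-vis (Adj G u) sep₁ vis₁ (λ v → holds-edge u v cur≡u refl) v)
      ; done-bits = done₂
      ; start     = λ a∉Z → ∈-satisfying⁺ visit? (inj₁ (start S a∉Z))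
      ; sound     = λ v∈V′ → [ sound S , (λ (v∉Z , u~v) → let a∉Z , a⟶u = sound S u∈V in
                      a∉Z , Reachable-snoc a∉Z a⟶u u~v v∉Z) ]′ (∈-satisfying⁻ visit? v∈V′)
      ; closed    = λ w∈D′ w~v v∉Z → ∈-satisfying⁺ visit?
          ([ (λ w∈D → inj₁ (closed S w∈D w~v v∉Z))
           , (λ w∈⁅u⁆ → inj₂ (v∉Z , subst (λ w → Adj G w _) (x∈⁅y⁆⇒x≡y u w∈⁅u⁆) w~v)) ]′
           (x∈p∪q⁻ D ⁅ u ⁆ w∈D′))
      ; progress  = [ (λ V⊆D → contradiction (V⊆D u∈V) u∉D)
                    , (λ i≤ → inj₂ (≤-<-trans i≤ (p⊂q⇒∣p∣<∣q∣
                        ((λ w∈D → x∈p∪q⁺ (inj₁ w∈D)) , u , x∈p∪q⁺ (inj₂ (x∈⁅x⁆ u)) , u∉D)))) ]′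
                    (progress S) }
      where
      visit? : Decidable (λ v → v ∈ V ⊎ (v ∉ Z × Adj G u v))
      visit? v = (v ∈? V) ⊎-dec (¬? (v ∈? Z) ×-dec T? (adj G u v))
      cur₂ : s₂ cur 0 ≡ toℕ u
      cur₂ = trans (filled {cur} _ _ 0) cur≡u
      done₂ : Bits (run expand s₁) done (D ∪ ⁅ u ⁆)
      bits done₂ v with v Fin.≟ u
      ... | yes refl = yes (x∈p∪q⁺ (inj₂ (x∈⁅x⁆ u))) ,
        trans (cong (run expand s₁ done) (sym cur₂)) (update-same s₂ done _ 1)
      ... | no v≢u = holds-map
        (λ v∈D → x∈p∪q⁺ (inj₁ v∈D))
        (λ v∈D′ → [ (λ v∈D → v∈D) , (λ v∈⁅u⁆ → contradiction (x∈⁅y⁆⇒x≡y u v∈⁅u⁆) v≢u) ]′ (x∈p∪q⁻ D ⁅ u ⁆ v∈D′))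
        (holds-cong (trans (update-index s₂ done _ 1 (λ v≡cur → v≢u (Fin.toℕ-injective (trans v≡cur cur₂))))
                           (filled {done} _ _ _)) (bits done₁ v))

  -- For `a` in `Z` this forces `V` to be empty. So the outcome of a search is described uniformly,
  -- also for tuples whose start vertex lies in the candidate separator.
  record Component (Z : Subset n) (a : Fin n) (V : Subset n) : Set where
    constructor component
    field
      within : ∀ {v} → v ∈ V → a ∉ Z × Reachable G Z a v
      covers : a ∉ Z → ∀ {v} → Reachable G Z a v → v ∈ V

  -- After n rounds either no visited vertex is unprocessed, or at least n vertices are processed,
  -- which is all of them. Then `closed` extends along every walk from `a`.
  searched⇒component : ∀ {Z a s} → Searching Z a n s → ∃[ V ] (Bits s vis V × Component Z a V)
  searched⇒component {Z} S = visited S , vis-bits S , component (sound S) (λ a∉Z → complete (start S a∉Z))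
    where
    all-processed : ∀ {v} → v ∈ visited S → v ∈ processed S
    all-processed v∈ with progress S
    ... | inj₁ V⊆D = V⊆D v∈
    ... | inj₂ n≤  = subst (_ ∈_) (sym (∣p∣≡n⇒p≡⊤ (≤-antisym (∣p∣≤n (processed S)) n≤))) ∈⊤
    complete : ∀ {u v} → u ∈ visited S → Reachable G Z u v → v ∈ visited S
    complete u∈ ε = u∈
    complete u∈ ((_ , w∉Z , u~w) ◅ r) = complete (closed S (all-processed u∈) u~w w∉Z) r

  search-spec : ∀ j {s Z a} → Bits s sep Z → s (tuple j) 0 ≡ toℕ a →
    ∃[ V ] (Bits (run (search (tuple j)) s) vis V × Component Z a V)
  search-spec j {s} {Z} {a} sep≐Z src≡ =
    searched⇒component (for-invariant round (select ▸ expand) (Searching Z a) _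
      (searching-round s₂ 0 initial)
      (λ v {s} _ S → searching-round (run (select ▸ expand) s) _ (search-step S)))
    where
    initial? : Decidable (λ v → v ≡ a × v ∉ Z)
    initial? v = (v Fin.≟ a) ×-dec ¬? (v ∈? Z)
    visP = fill row vis (andE (eq (var row) (var (tuple j))) (notE (sep ! var row)))
    doneP = fill row done (lit 0)
    s₁ = run visP s
    s₂ = run doneP s₁
    vis₁ : Bits s₁ vis (satisfying initial?)
    bits vis₁ v = holds-map (∈-satisfying⁺ initial?) (∈-satisfying⁻ initial?)
      (fill-spec row vis (andE (eq (var row) (var (tuple j))) (notE (sep ! var row))) _ _ {s}
        (λ v x → Holds x (v ≡ a × v ∉ Z))
        (λ v {s′} row≡ _ rest → holds-and {s′} (eq (var row) (var (tuple j))) (notE (sep ! var row))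
          (holds-≡ v a row≡ (trans (rest 0 _ _) src≡))
          (holds-not {s′} (sep ! var row) (holds-cong (trans (cong (s′ sep) row≡) (rest _ _ _)) (bits sep≐Z v)))) v)
    initial : Searching Z a 0 s₂
    initial = record
      { sep-bits  = bits-frame (visP ▸ doneP) s _ sep≐Z
      ; vis-bits  = bits-frame doneP s₁ _ vis₁
      ; done-bits = mkBits (fill-spec row done (lit 0) _ _ {s₁} (λ v x → Holds x (v ∈ ∅))
          (λ v _ _ _ → no ∉⊥ , refl))
      ; start     = λ a∉Z → ∈-satisfying⁺ initial? (refl , a∉Z)
      ; sound     = λ v∈ → sound₀ (∈-satisfying⁻ initial? v∈)
      ; closed    = λ u∈⊥ → ⊥-elim (∉⊥ u∈⊥)
      ; progress  = inj₂ z≤n }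
      where
      sound₀ : ∀ {v} → v ≡ a × v ∉ Z → a ∉ Z × Reachable G Z a v
      sound₀ (refl , a∉Z) = a∉Z , ε

  conj-spec : ∀ {s P Q} e → Holds (s ok 0) P → Holds (eval G s e) Q →
              Holds (run (conj e) s ok 0) (P × Q)
  conj-spec {s} e = holds-and {s} (var ok) e

  Dominated : Subset n → Subset n → (ℕ → Set) → Set
  Dominated Z V bound = ∀ c → bound (toℕ c) → c ∈ Z → ∃[ u ] (u ∈ V × Adj G u c)

  hit-spec : ∀ {s V} c → Bits s vis V → s row 0 ≡ toℕ c →
    Holds (run hitP s hit 0) (∃[ u ] (toℕ u < n × u ∈ V × Adj G u c))
  hit-spec {s} {V} c vis≐V row≡ = proj₁ (for-invariant col body I {s [ hit , 0 ↦ 0 ]} _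
      ((no (λ ()) , refl) , mkBits (bits vis≐V) , row≡) step)
    where
    e = andE (vis ! var col) (edge (var col) (var row))
    body = asg hit (lit 0) (orE (var hit) e)
    I : ℕ → Store → Set
    I i s = Holds (s hit 0) (∃[ u ] (toℕ u < i × u ∈ V × Adj G u c)) × Bits s vis V × s row 0 ≡ toℕ c
    step : ∀ v {s} → s col 0 ≡ toℕ v → I (toℕ v) s → I (suc (toℕ v)) (tick col (run body s))
    step v {s} col≡ (found , vis≐V , row≡) =
      holds-map
        [ (λ (u , u<v , p) → u , m<n⇒m<1+n u<v , p) , (λ p → v , ≤-refl , p) ]′ last
        (holds-or {s} (var hit) e found
          (holds-and {s} (vis ! var col) (edge (var col) (var row))
            (bits-at vis≐V v col≡) (holds-edge v c col≡ row≡)))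
      , mkBits (bits vis≐V) , row≡
      where
      last : (∃[ u ] (toℕ u < suc (toℕ v) × u ∈ V × Adj G u c)) →
             (∃[ u ] (toℕ u < toℕ v × u ∈ V × Adj G u c)) ⊎ (v ∈ V × Adj G v c)
      last (u , u≤v , p) with m≤n⇒m<n∨m≡n (s≤s⁻¹ u≤v)
      ... | inj₁ u<v = inj₁ (u , u<v , p)
      ... | inj₂ u≡v with Fin.toℕ-injective u≡v
      ...   | refl = inj₂ p

  dominate-spec : ∀ {s Z V P} → Bits s sep Z → Bits s vis V → Holds (s ok 0) P →
    Holds (run dominate s ok 0) (P × Dominated Z V (_< n))
      × Bits (run dominate s) vis V
  dominate-spec {s} {Z} {V} {P} sep≐Z vis≐V ok≐P =
    let _ , vis≐ , ok≐ = for-invariant row body I {s} _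
          (mkBits (bits sep≐Z) , mkBits (bits vis≐V) , holds-map (λ p → p , λ _ ()) proj₁ ok≐P) step
    in ok≐ , vis≐
    where
    e = orE (notE (sep ! var row)) (var hit)
    body = hitP ▸ conj e
    I : ℕ → Store → Set
    I i s = Bits s sep Z × Bits s vis V × Holds (s ok 0) (P × Dominated Z V (_< i))
    step : ∀ c {s} → s row 0 ≡ toℕ c → I (toℕ c) s → I (suc (toℕ c)) (tick row (run body s))
    step c {s} row≡ (sep≐Z , vis≐V , ok≐) =
        mkBits (bits (bits-frame body s _ sep≐Z)) , mkBits (bits (bits-frame body s _ vis≐V))
      , holds-map
          (λ ((p , dom) , last) → p , extend dom last)
          (λ (p , dom) → (p , λ c′ c′<c → dom c′ (m<n⇒m<1+n c′<c)) , final (dom c ≤-refl))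
          (conj-spec {run hitP s} e (holds-cong (frame hitP _ s 0) ok≐)
            (holds-or {run hitP s} (notE (sep ! var row)) (var hit)
              (holds-not {run hitP s} (sep ! var row)
                (bits-at (bits-frame hitP s _ sep≐Z) c (trans (frame hitP _ s 0) row≡)))
              (hit-spec {s} c vis≐V row≡)))
      where
      extend : Dominated Z V (_< toℕ c) → c ∉ Z ⊎ (∃[ u ] (toℕ u < n × u ∈ V × Adj G u c)) →
               Dominated Z V (_< suc (toℕ c))
      extend dom last c′ c′≤c c′∈Z with m≤n⇒m<n∨m≡n (s≤s⁻¹ c′≤c)
      ... | inj₁ c′<c = dom c′ c′<c c′∈Z
      ... | inj₂ c′≡c with Fin.toℕ-injective c′≡c
      ...   | refl = [ contradiction c′∈Z , (λ (u , _ , p) → u , p) ]′ last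
      final : (c ∈ Z → ∃[ u ] (u ∈ V × Adj G u c)) → c ∉ Z ⊎ (∃[ u ] (toℕ u < n × u ∈ V × Adj G u c))
      final dom with c ∈? Z
      ... | no  c∉Z = inj₁ c∉Z
      ... | yes c∈Z = let u , p = dom c∈Z in inj₂ (u , Fin.toℕ<n u , p)

  check-spec : ∀ j {s Z a P} → Bits s sep Z → s (tuple j) 0 ≡ toℕ a → Holds (s ok 0) P →
    ∃[ V ] (Component Z a V × Bits (run (check (tuple j)) s) vis V
            × Holds (run (check (tuple j)) s ok 0) (P × FullFrom Z a))
  check-spec j {s} {Z} {a} {P} sep≐Z src≡ ok≐P = go (search-spec j sep≐Z src≡)
    where
    s₁ = run (search (tuple j)) s
    s₂ = run (conj (vis ! var (tuple j))) s₁
    go : ∃[ V ] (Bits s₁ vis V × Component Z a V) → _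
    go (V , vis₁ , component sound complete) = V , component sound complete , proj₂ result , holds-map
        (λ ((p , a∈V) , dom) → p , full a∈V dom)
        (λ (p , a∉Z , dom) → (p , complete a∉Z ε) , λ c _ c∈Z → let u , r , u~c = dom c c∈Z in
          u , complete a∉Z r , u~c)
        (proj₁ result)
      where
      full : a ∈ V → Dominated Z V (_< n) → FullFrom Z a
      full a∈V dom = proj₁ (sound a∈V) , λ c c∈Z → let u , u∈V , u~c = dom c (Fin.toℕ<n c) c∈Z in
        u , proj₂ (sound u∈V) , u~c
      result = dominate-spec {s₂}
        (mkBits (bits (bits-frame (search (tuple j)) s _ sep≐Z))) (mkBits (bits vis₁))
        (conj-spec {s₁} (vis ! var (tuple j)) (holds-cong (frame (search (tuple j)) _ s 0) ok≐P)
          (bits-at vis₁ a (trans (frame (search (tuple j)) _ s 0) src≡)))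

  test-spec : ∀ m t {s} → (∀ i → i < suc m + suc m → s (tuple i) 0 ≡ toℕ (t i)) →
    let Z = cut (suc m) t in
    Bits (run (test (suc m)) s) sep Z
    × Holds (run (test (suc m)) s ok 0) (Separates Z (t 0) (t (suc m)))
    × ∃[ V ] Component Z (t 0) V × ∃[ W ] Component Z (t (suc m)) W
  test-spec m t {s} reads = first (check-spec 0 sep₁ reads₀ (yes tt , refl))
    where
    Z = cut (suc m) t
    p₁ = cutP (suc m) ▸ asg ok (lit 0) (lit 1)
    s₁ = run p₁ s
    s₂ = run (check (tuple 0)) s₁
    s₃ = run (conj (notE (vis ! var (tuple (suc m))))) s₂
    s₄ = run (check (tuple (suc m))) s₃
    sep₁ : Bits s₁ sep Z
    sep₁ = mkBits (bits (cut-spec (suc m) t reads))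
    reads₀ : s₁ (tuple 0) 0 ≡ toℕ (t 0)
    reads₀ = trans (frame p₁ _ s 0) (reads 0 z<s)
    sep₂ : Bits s₂ sep Z
    sep₂ = bits-frame (check (tuple 0)) s₁ _ sep₁
    reads₂ : s₂ (tuple (suc m)) 0 ≡ toℕ (t (suc m))
    reads₂ = trans (frame (check (tuple 0)) _ s₁ 0)
               (trans (frame p₁ _ s 0) (reads (suc m) (m<m+n (suc m) z<s)))
    Result = Bits s₄ sep Z × Holds (s₄ ok 0) (Separates Z (t 0) (t (suc m)))
           × ∃[ V ] Component Z (t 0) V × ∃[ W ] Component Z (t (suc m)) W
    first : ∃[ V ] (Component Z (t 0) V × Bits s₂ vis V × Holds (s₂ ok 0) (⊤ × FullFrom Z (t 0))) → Result
    first (V , component sound complete , vis₂ , ok₂) =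
      second (check-spec (suc m) {s₃} (mkBits (bits sep₂)) reads₂
        (conj-spec {s₂} (notE (vis ! var (tuple (suc m)))) ok₂
          (holds-not {s₂} (vis ! var (tuple (suc m))) (bits-at vis₂ (t (suc m)) reads₂))))
      where
      second : ∃[ W ] (Component Z (t (suc m)) W × Bits s₄ vis W
                 × Holds (s₄ ok 0) (((⊤ × FullFrom Z (t 0)) × t (suc m) ∉ V) × FullFrom Z (t (suc m)))) → Result
      second (W , compW , _ , ok₄) =
        bits-frame (check (tuple (suc m))) s₃ _ (mkBits (bits sep₂)) ,
        holds-map
          (λ (((_ , fullₐ) , b∉V) , fullᵇ) → fullₐ , fullᵇ , λ r → b∉V (complete (proj₁ fullₐ) r))
          (λ (fullₐ , fullᵇ , a≁b) → ((tt , fullₐ) , λ b∈V → a≁b (proj₂ (sound b∈V))) , fullᵇ)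
          ok₄ ,
        V , component sound complete , W , compW

  -- Insertion into the trie

  kids-update : ∀ s a i v → T (not (10 ≡ᵇ a)) → T (not (11 ≡ᵇ a)) →
                ∀ b j → kids (s [ a , i ↦ v ]) b j ≡ kids s b j
  kids-update s a i v f g false j = update-other s a i v j f
  kids-update s a i v f g true  j = update-other s a i v j g

  kids-frame : ∀ p → Fresh 10 p → Fresh 11 p → ∀ s b j → kids (run p s) b j ≡ kids s b j
  kids-frame p f g s false j = frame p f s j
  kids-frame p f g s true  j = frame p g s j

  TrieIn : Store → Set
  TrieIn s = Trie (kids s) (s next 0)

  record Descended (s : Store) (b : Bool) (s′ : Store) : Set where
    field
      trie  : TrieIn s′
      grows : kids s ⊑ kids s′
      at    : s′ node 0 ≡ s node 0
      alive : kids s′ b (s node 0) ≢ 0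

  allocate : ℕ → Prog
  allocate a = asg a (var node) (var next) ▸ asg next (lit 0) (inc (var next))

  allocate-spec : ∀ s b → TrieIn s → s node 0 ≢ 0 → kids s b (s node 0) ≡ 0 →
                  Descended s b (run (allocate (child b)) s)
  allocate-spec s b t v≢0 vacant = record
    { trie  = subst (Trie (kids s₂)) (cong suc (sym (keep next b))) (trie-extend b v t v≢0 new other)
    ; grows = λ b′ j A≢0 → [ (λ { (refl , refl) → contradiction vacant A≢0 }) , (λ old → old) ]′ (other b′ j)
    ; at    = keep node b
    ; alive = λ A≡0 → <⇒≢ (<-trans z<s (2≤M t)) (trans (sym A≡0) new) }
    where
    v = s node 0
    s₁ = s [ child b , v ↦ s next 0 ]
    s₂ = run (allocate (child b)) s
    keep : ∀ a b {_ : T (not (a ≡ᵇ 10))} {_ : T (not (a ≡ᵇ 11))} →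
           (s [ child b , v ↦ s next 0 ]) a 0 ≡ s a 0
    keep a false {f} = update-other s 10 v _ 0 f
    keep a true {_} {g} = update-other s 11 v _ 0 g
    new : kids s₂ b v ≡ s next 0
    new = trans (kids-update s₁ next 0 _ _ _ b v) (update-same s (child b) v _)
    other : ∀ b′ j → (b′ ≡ b × j ≡ v) ⊎ kids s₂ b′ j ≡ kids s b′ j
    other b′ j with j ≟ v
    ... | no j≢v = inj₂ (trans (kids-update s₁ next 0 _ _ _ b′ j) (elsewhere b b′))
      where
      elsewhere : ∀ b b′ → (s [ child b , v ↦ s next 0 ]) (child b′) j ≡ s (child b′) j
      elsewhere false false = update-index s 10 v _ j≢v
      elsewhere false true  = refl
      elsewhere true  false = refl
      elsewhere true  true  = update-index s 11 v _ j≢v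
    ... | yes j≡v with b′ Data.Bool.≟ b
    ...   | yes b′≡b = inj₁ (b′≡b , j≡v)
    ...   | no  b′≢b = inj₂ (trans (kids-update s₁ next 0 _ _ _ b′ j) (elsewhere b b′ b′≢b))
      where
      elsewhere : ∀ b b′ → b′ ≢ b → (s [ child b , v ↦ s next 0 ]) (child b′) j ≡ s (child b′) j
      elsewhere false true  _    = refl
      elsewhere true  false _    = refl
      elsewhere false false b′≢b = contradiction refl b′≢b
      elsewhere true  true  b′≢b = contradiction refl b′≢b

  record Inserted (Z : Subset n) (s₀ : Store) (i : ℕ) (s : Store) : Set where
    field
      bits-in : Bits s sep Z
      trie    : TrieIn s
      grows   : kids s₀ ⊑ kids s
      alive   : s node 0 ≢ 0
      reached : s node 0 ≡ walk (kids s) (nth Z) i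

  -- The current node was reached in a possibly smaller trie. Growth keeps all existing edges, so
  -- the node is still the end of the same walk after an allocation.
  insert-step : ∀ {Z s₀ s} v → Inserted Z s₀ (toℕ v) s →
    Inserted Z s₀ (suc (toℕ v)) (run (descend (child (lookup Z v))) s)
  insert-step {Z} {s₀} {s} v I = finish (found (lookup Z v))
    where
    open Inserted I
    b = lookup Z v
    s₁ = λ b → run (cond (child b ! var node) nop (allocate (child b))) s
    found : ∀ b → Descended s b (s₁ b)
    found b with s (child b) (s node 0) in vacant
    ... | zero  = allocate-spec s b trie alive vacant
    ... | suc _ = record
      { trie = trie ; grows = λ _ _ _ → refl ; at = refl
      ; alive = λ A≡0 → 0≢1+n (trans (sym A≡0) vacant) }
    finish : Descended s b (s₁ b) → Inserted Z s₀ (suc (toℕ v)) (run (descend (child b)) s)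
    finish D = record
      { bits-in = mkBits (bits (bits-frame (descend (child b)) s (fresh b) bits-in))
      ; trie    = trie-cong kids≡ refl D.trie
      ; grows   = ⊑-trans grows grows′
      ; alive   = λ node≡0 → D.alive (trans (cong (kids (s₁ b) b) (sym D.at)) node≡0)
      ; reached = begin
          kids (s₁ b) b (s₁ b node 0)                         ≡⟨ cong (kids (s₁ b) b) D.at ⟩
          kids (s₁ b) b (s node 0)                            ≡⟨ sym (kids≡ b _) ⟩
          kids s₂ b (s node 0)                                ≡⟨ cong (kids s₂ b) node≡ ⟩
          kids s₂ b (walk (kids s₂) (nth Z) (toℕ v))
            ≡⟨ cong (λ b → kids s₂ b (walk (kids s₂) (nth Z) (toℕ v))) (sym (nth-toℕ Z v)) ⟩
          walk (kids s₂) (nth Z) (suc (toℕ v))                ∎ }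
      where
      open ≡-Reasoning
      module D = Descended D
      s₂ = run (descend (child b)) s
      fresh : ∀ b → Fresh sep (descend (child b))
      fresh false = _
      fresh true  = _
      kids≡ : ∀ b′ j → kids s₂ b′ j ≡ kids (s₁ b) b′ j
      kids≡ = kids-update (s₁ b) node 0 _ _ _
      grows′ : kids s ⊑ kids s₂
      grows′ b′ j A≢0 = trans (kids≡ b′ j) (D.grows b′ j A≢0)
      node≡ : s node 0 ≡ walk (kids s₂) (nth Z) (toℕ v)
      node≡ = trans reached (sym (walk-⊑ trie grows′ (nth Z) (toℕ v) (λ w≡0 → alive (trans reached w≡0))))

  inserted-row : ∀ {Z s₀ i} s r → Inserted Z s₀ i s → Inserted Z s₀ i (s [ row , 0 ↦ r ])
  inserted-row {Z} {i = i} s r I = record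
    { bits-in = mkBits (bits (bits-in))
    ; trie    = trie-cong kids≡ refl trie
    ; grows   = ⊑-trans grows (λ b j _ → kids≡ b j)
    ; alive   = alive
    ; reached = trans reached (sym (walk-cong kids≡ (nth Z) i)) }
    where
    open Inserted I
    kids≡ : ∀ b j → kids (s [ row , 0 ↦ r ]) b j ≡ kids s b j
    kids≡ = kids-update s row 0 r _ _

  insert-spec : ∀ {s Z} → Bits s sep Z → TrieIn s → Inserted Z s n (run insert s)
  insert-spec {s} {Z} sep≐Z t = for-invariant row body (Inserted Z s) _
    (inserted-row s₁ 0 (record
      { bits-in = mkBits (bits sep≐Z)
      ; trie    = trie-cong kids≡ refl t
      ; grows   = λ b j _ → kids≡ b j
      ; alive   = λ ()
      ; reached = refl })) step
    where
    body = cond (sep ! var row) (descend (child true)) (descend (child false))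
    s₁ = s [ node , 0 ↦ 1 ]
    kids≡ : ∀ b j → kids s₁ b j ≡ kids s b j
    kids≡ = kids-update s node 0 1 _ _
    step : ∀ v {s′} → s′ row 0 ≡ toℕ v → Inserted Z s (toℕ v) s′ →
           Inserted Z s (suc (toℕ v)) (tick row (run body s′))
    step v {s′} row≡ I = inserted-row (run body s′) _
      (choose (bits-at (Inserted.bits-in I) v row≡))
      where
      choose : Holds (s′ sep (s′ row 0)) (v ∈ Z) → Inserted Z s (suc (toℕ v)) (run body s′)
      choose (yes v∈Z , bit≡) =
        subst (Inserted Z s (suc (toℕ v)))
          (trans (cong (λ b → run (descend (child b)) s′) (∈⇒lookup v∈Z))
                 (sym (cong (λ x → branch x (run (descend 11) s′) (run (descend 10) s′)) bit≡)))
          (insert-step v I)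
      choose (no v∉Z , bit≡) =
        subst (Inserted Z s (suc (toℕ v)))
          (trans (cong (λ b → run (descend (child b)) s′) (∉⇒lookup v∉Z))
                 (sym (cong (λ x → branch x (run (descend 11) s′) (run (descend 10) s′)) bit≡)))
          (insert-step v I)

  -- Printing each separator once

  leaf : Store → Subset n → ℕ
  leaf s Z = walk (kids s) (nth Z) n

  -- `marked` and `only` make the marked nodes exactly the leaves of the sets in `Cs`. Correctness
  -- of everything printed travels along as `unique` and `minimal`.
  record Seen (Cs : List (Subset n)) (s : Store) : Set where
    field
      trie    : TrieIn s
      marked  : ∀ {Z} → Z ∈ˡ Cs → leaf s Z ≢ 0 × s mark (leaf s Z) ≢ 0
      only    : ∀ j → s mark j ≢ 0 → ∃[ Z ] (Z ∈ˡ Cs × leaf s Z ≡ j)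
      unique  : Unique Cs
      minimal : ∀ {Z} → Z ∈ˡ Cs → IsMinimalSeparator G Z

  seen-cong : ∀ {Cs s s′} → (∀ b j → kids s′ b j ≡ kids s b j) → s′ next 0 ≡ s next 0 →
              (∀ j → s′ mark j ≡ s mark j) → Seen Cs s → Seen Cs s′
  seen-cong {s = s} {s′} kids≡ next≡ mark≡ S = record
    { trie    = trie-cong kids≡ next≡ trie
    ; marked  = λ {Z} Z∈ → let alive , m≢0 = marked Z∈ in
        (λ l≡0 → alive (trans (sym (leaf≡ Z)) l≡0)) ,
        (λ m≡0 → m≢0 (trans (sym (trans (cong (s′ mark) (leaf≡ Z)) (mark≡ _))) m≡0))
    ; only    = λ j m≢0 → let Z , Z∈ , leaf≡j = only j (λ m≡0 → m≢0 (trans (mark≡ j) m≡0)) in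
        Z , Z∈ , trans (leaf≡ Z) leaf≡j
    ; unique  = unique
    ; minimal = minimal }
    where
    open Seen S
    leaf≡ : ∀ Z → leaf s′ Z ≡ leaf s Z
    leaf≡ Z = walk-cong kids≡ (nth Z) n

  seen-frame : ∀ p → Fresh 10 p → Fresh 11 p → Fresh next p → Fresh mark p →
               ∀ {Cs s} → Seen Cs s → Seen Cs (run p s)
  seen-frame p f₁₀ f₁₁ fₙ fₘ {s = s} = seen-cong (kids-frame p f₁₀ f₁₁ s) (frame p fₙ s 0) (frame p fₘ s)

  -- `covered` asks for completeness only, soundness being part of `Seen`. It is preserved when more
  -- sets are added, so consecutive iterations combine by concatenating lists and adding bounds.
  record Extends (Cs : List (Subset n)) (Q : Subset n → Set) (bound : ℕ) (o : List ℕ) (s : Store) : Set where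
    constructor extends
    field
      {added} : List (Subset n)
      few     : length added ≤ bound
      printed : o ≡ encode added
      seen    : Seen (Cs ++ added) s
      covered : ∀ {Z} → Q Z → Z ∈ˡ Cs ++ added

  extends-none : ∀ {Cs Q bound s} → Seen Cs s → (∀ {Z} → Q Z → Z ∈ˡ Cs) → Extends Cs Q bound [] s
  extends-none {Cs} S cov = extends z≤n refl (subst (λ Cs → Seen Cs _) (sym (List.++-identityʳ Cs)) S)
    (λ q → ∈-++⁺ˡ (cov q))

  print-spec : ∀ {s Z} → Bits s sep Z → out (for row (prt (sep ! var row))) s ≡ map bit (toList Z)
  print-spec {s} {Z} sep≐Z =
    trans (sym (trans (cong (o ++_) (cong (map bit) (drop-toList Z))) (List.++-identityʳ o)))
          (proj₂ (for-invariant-out row (prt (sep ! var row)) I {s} _ (mkBits (bits sep≐Z) , refl) step))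
    where
    o = out (for row (prt (sep ! var row))) s
    I : ℕ → List ℕ → Store → Set
    I i o s = Bits s sep Z × o ++ map bit (drop i (toList Z)) ≡ map bit (toList Z)
    drop-toList : ∀ {k} (Z : Subset k) → drop k (toList Z) ≡ []
    drop-toList []      = refl
    drop-toList (_ ∷ Z) = drop-toList Z
    drop-toℕ : ∀ {k} (Z : Subset k) v → drop (toℕ v) (toList Z) ≡ lookup Z v ∷ drop (suc (toℕ v)) (toList Z)
    drop-toℕ (_ ∷ Z) zero    = refl
    drop-toℕ (_ ∷ Z) (suc v) = drop-toℕ Z v
    holds-bit : ∀ {x v} → Holds x (v ∈ Z) → x ≡ bit (lookup Z v)
    holds-bit (yes v∈Z , x≡) = trans x≡ (cong bit (sym (∈⇒lookup v∈Z)))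
    holds-bit (no v∉Z , x≡)  = trans x≡ (cong bit (sym (∉⇒lookup v∉Z)))
    step : ∀ v {o s} → s row 0 ≡ toℕ v → I (toℕ v) o s →
           I (suc (toℕ v)) (o ++ s sep (s row 0) ∷ []) (tick row s)
    step v {o} {s} row≡ (sep≐Z , o++≡) = mkBits (bits sep≐Z) , (begin
      (o ++ s sep (s row 0) ∷ []) ++ map bit (drop (suc (toℕ v)) (toList Z))
        ≡⟨ List.++-assoc o _ _ ⟩
      o ++ s sep (s row 0) ∷ map bit (drop (suc (toℕ v)) (toList Z))
        ≡⟨ cong (λ x → o ++ x ∷ map bit (drop (suc (toℕ v)) (toList Z))) (holds-bit (bits-at sep≐Z v row≡)) ⟩
      o ++ map bit (lookup Z v ∷ drop (suc (toℕ v)) (toList Z))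
        ≡⟨ cong (λ l → o ++ map bit l) (sym (drop-toℕ Z v)) ⟩
      o ++ map bit (drop (toℕ v) (toList Z))
        ≡⟨ o++≡ ⟩
      map bit (toList Z) ∎)
      where open ≡-Reasoning

  emit-spec : ∀ {Cs s Z} → Bits s sep Z → IsMinimalSeparator G Z → Seen Cs s →
              Extends Cs (_≡ Z) 1 (out emit s) (run emit s)
  emit-spec {Cs} {s} {Z} sep≐Z minimalZ S =
    subst (λ o → Extends Cs (_≡ Z) 1 (o ++ out fin s₁) (run fin s₁)) (sym (silent insert _ s))
      finish
    where
    open Seen S
    s₁ = run insert s
    report = asg mark (var node) (lit 1) ▸ for row (prt (sep ! var row))
    fin = cond (mark ! var node) nop report
    I : Inserted Z s n s₁
    I = insert-spec sep≐Z trie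
    module I = Inserted I
    mark₁ : ∀ j → s₁ mark j ≡ s mark j
    mark₁ = frame insert _ s
    leaf₁ : ∀ Z′ → leaf s Z′ ≢ 0 → leaf s₁ Z′ ≡ leaf s Z′
    leaf₁ Z′ = walk-⊑ trie I.grows (nth Z′) n
    S₁ : Seen Cs s₁
    S₁ = record
      { trie    = I.trie
      ; marked  = λ {Z′} Z′∈ → let alive , m≢0 = marked Z′∈ in
          (λ l≡0 → alive (trans (sym (leaf₁ Z′ alive)) l≡0)) ,
          (λ m≡0 → m≢0 (trans (sym (trans (cong (s₁ mark) (leaf₁ Z′ alive)) (mark₁ _))) m≡0))
      ; only    = λ j m≢0 → let Z′ , Z′∈ , l≡j = only j (λ m≡0 → m≢0 (trans (mark₁ j) m≡0)) in
          Z′ , Z′∈ , trans (leaf₁ Z′ (proj₁ (marked Z′∈))) l≡j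
      ; unique  = unique
      ; minimal = minimal }
    module S₁ = Seen S₁
    finish : Extends Cs (_≡ Z) 1 (out fin s₁) (run fin s₁)
    finish with s₁ mark (s₁ node 0) in m≡
    -- The mark shows that the leaf belongs to a listed set `Z′`; sharing a nonzero leaf, `Z` and
    -- `Z′` are equal.
    ... | suc _ = extends-none S₁ λ { refl →
      let Z′ , Z′∈ , l≡ = S₁.only (s₁ node 0) (λ m≡0 → 0≢1+n (trans (sym m≡0) m≡))
          Z≡Z′ = nth-injective (walk-injective I.trie (nth Z) (nth Z′) n
            (λ l≡0 → I.alive (trans I.reached l≡0)) (trans (sym I.reached) (sym l≡)))
      in subst (_∈ˡ Cs) (sym Z≡Z′) Z′∈ }
    ... | zero = extends {added = Z ∷ []} (s≤s z≤n)
      (trans (print-spec (mkBits (bits I.bits-in))) (sym (List.++-identityʳ _)))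
      (record
        { trie    = trie-cong kids₂ (frame report _ s₁ 0) I.trie
        ; marked  = λ Z′∈ → [ old , (λ { (here refl) → new }) ]′ (∈-++⁻ Cs Z′∈)
        ; only    = only₂
        ; unique  = Unique.++⁺ unique (All.[] ∷ []) λ { (Z∈Cs , here refl) → Z∉Cs Z∈Cs }
        ; minimal = λ Z′∈ → [ minimal , (λ { (here refl) → minimalZ }) ]′ (∈-++⁻ Cs Z′∈) })
      λ { refl → ∈-++⁺ʳ Cs (here refl) }
      where
      s₂ = run report s₁
      kids₂ : ∀ b j → kids s₂ b j ≡ kids s₁ b j
      kids₂ = kids-frame report _ _ s₁
      leaf₂ : ∀ Z′ → leaf s₂ Z′ ≡ leaf s₁ Z′
      leaf₂ Z′ = walk-cong kids₂ (nth Z′) n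
      printing = for row (prt (sep ! var row))
      mark₂ : ∀ {j} → j ≢ s₁ node 0 → s₂ mark j ≡ s₁ mark j
      mark₂ {j} j≢ = trans (frame printing _ _ j) (update-index s₁ mark _ 1 j≢)
      mark-node : s₂ mark (s₁ node 0) ≡ 1
      mark-node = trans (frame printing _ _ (s₁ node 0)) (update-same s₁ mark (s₁ node 0) 1)
      Z∉Cs : ¬ Z ∈ˡ Cs
      Z∉Cs Z∈ = proj₂ (S₁.marked Z∈) (trans (cong (s₁ mark) (sym I.reached)) m≡)
      old : ∀ {Z′} → Z′ ∈ˡ Cs → leaf s₂ Z′ ≢ 0 × s₂ mark (leaf s₂ Z′) ≢ 0
      old {Z′} Z′∈ = let alive , m≢0 = S₁.marked Z′∈ in
        (λ l≡0 → alive (trans (sym (leaf₂ Z′)) l≡0)) ,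
        (λ m≡0 → m≢0 (trans (sym (trans (cong (s₂ mark) (leaf₂ Z′))
          (mark₂ (λ l≡ → m≢0 (trans (cong (s₁ mark) l≡) m≡))))) m≡0))
      leafZ : leaf s₂ Z ≡ s₁ node 0
      leafZ = trans (leaf₂ Z) (sym I.reached)
      new : leaf s₂ Z ≢ 0 × s₂ mark (leaf s₂ Z) ≢ 0
      new = (λ l≡0 → I.alive (trans (sym leafZ) l≡0)) ,
            (λ m≡0 → 0≢1+n (trans (sym m≡0) (trans (cong (s₂ mark) leafZ) mark-node)))
      only₂ : ∀ j → s₂ mark j ≢ 0 → ∃[ Z′ ] (Z′ ∈ˡ Cs ++ Z ∷ [] × leaf s₂ Z′ ≡ j)
      only₂ j m≢0 with j ≟ s₁ node 0
      ... | yes refl = Z , ∈-++⁺ʳ Cs (here refl) , leafZ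
      ... | no  j≢   = let Z′ , Z′∈ , l≡j = S₁.only j (λ m≡0 → m≢0 (trans (mark₂ j≢) m≡0)) in
        Z′ , ∈-++⁺ˡ Z′∈ , trans (leaf₂ Z′) l≡j

  -- The loops over all tuples

  Generates : ℕ → (ℕ → Fin n) → Subset n → Set
  Generates m t Z = cut m t ≡ Z × Separates Z (t 0) (t m)

  core-spec : ∀ m t {Cs s} → (∀ i → i < suc m + suc m → s (tuple i) 0 ≡ toℕ (t i)) → Seen Cs s →
              Extends Cs (Generates (suc m) t) 1 (out (core (suc m)) s) (run (core (suc m)) s)
  core-spec m t {Cs} {s} reads S =
    subst (λ o → Extends Cs (Generates (suc m) t) 1 (o ++ out fin s₁) (run fin s₁))
      (sym (silent (test (suc m)) _ s)) (finish (test-spec m t reads))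
    where
    Z = cut (suc m) t
    s₁ = run (test (suc m)) s
    fin = cond (var ok) emit nop
    S₁ : Seen Cs s₁
    S₁ = seen-frame (test (suc m)) _ _ _ _ S
    finish : Bits s₁ sep Z × Holds (s₁ ok 0) (Separates Z (t 0) (t (suc m)))
               × ∃[ V ] Component Z (t 0) V × ∃[ W ] Component Z (t (suc m)) W →
             Extends Cs (Generates (suc m) t) 1 (out fin s₁) (run fin s₁)
    finish (sep≐Z , (yes separates , ok≡1) , V , compV , W , compW) =
      subst (λ x → Extends Cs (Generates (suc m) t) 1 (branch x (out emit s₁) []) (branch x (run emit s₁) s₁))
        (sym ok≡1) (weaken (emit-spec sep≐Z
          (separates⇒minimal separates (is-component compV) (is-component compW)) S₁))
      where
      is-component : ∀ {a V} → Component Z a V → a ∉ Z → (_∈ V) ≐ Reachable G Z a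
      is-component (component within covers) a∉Z = (λ v∈V → proj₂ (within v∈V)) , covers a∉Z
      weaken : ∀ {o s} → Extends Cs (_≡ Z) 1 o s → Extends Cs (Generates (suc m) t) 1 o s
      weaken (extends few printed seen covered) =
        extends few printed seen (λ (Z≡ , _) → covered (sym Z≡))
    finish (sep≐Z , (no ¬separates , ok≡0) , _) =
      subst (λ x → Extends Cs (Generates (suc m) t) 1 (branch x (out emit s₁) []) (branch x (run emit s₁) s₁))
        (sym ok≡0) (extends-none S₁ λ { (refl , separates) → contradiction separates ¬separates })

  adjacent-cong : ∀ m {x y : ℕ → Fin n} v → (∀ i → i < m → x i ≡ y i) → adjacent m x v ≡ adjacent m y v
  adjacent-cong zero    v x≗y = refl
  adjacent-cong (suc m) v x≗y =
    cong₂ _∨_ (cong (λ u → adj G u v) (x≗y m ≤-refl)) (adjacent-cong m v (λ i i<m → x≗y i (m<n⇒m<1+n i<m)))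

  -- Tuples are functions on all of ℕ, while the store determines only the entries of the two
  -- halves; agreement on these has to suffice.
  generates-cong : ∀ m {t t′ Z} → (∀ i → i < suc m + suc m → t i ≡ t′ i) →
                   Generates (suc m) t Z → Generates (suc m) t′ Z
  generates-cong m t≗t′ (cut≡Z , separates) =
    trans (tabulate-cong (λ v → sym (cong₂ _∧_
      (adjacent-cong (suc m) v (λ i i<m → t≗t′ i (m≤n⇒m≤n+o (suc m) i<m)))
      (adjacent-cong (suc m) v (λ i i<m → t≗t′ (i + suc m) (+-monoˡ-< (suc m) i<m)))))) cut≡Z ,
    subst₂ (Separates _) (t≗t′ 0 z<s) (t≗t′ (suc m) (m<m+n (suc m) z<s)) separates

  -- In `nest` the loop of the highest index is outermost. Inside the innermost `j` loops the
  -- entries from `j` on are fixed by `t`, and the lower ones range over all vertices.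
  GeneratedAbove : ℕ → ℕ → (ℕ → Fin n) → Subset n → Set
  GeneratedAbove m j t Z = ∃[ t′ ] ((∀ i → j ≤ i → i < m + m → t′ i ≡ t i) × Generates m t′ Z)

  Visits : ℕ → Prog → Set
  Visits m p = ∀ t {Cs s} → (∀ i → i < m + m → s (tuple i) 0 ≡ toℕ (t i)) → Seen Cs s →
               Extends Cs (Generates m t) 1 (out p s) (run p s)

  -- By induction on `j`: iteration v of the loop over entry `j` covers the tuples with that entry
  -- equal to v and adds at most `n ^ j` sets, so n iterations add at most `n ^ suc j`.
  nest-spec : ∀ m q → (∀ i → Fresh (tuple i) q) → Visits (suc m) q → ∀ j t {Cs s} → j ≤ suc m + suc m →
    (∀ i → j ≤ i → i < suc m + suc m → s (tuple i) 0 ≡ toℕ (t i)) → Seen Cs s →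
    Extends Cs (GeneratedAbove (suc m) j t) (n ^ j) (out (nest j q) s) (run (nest j q) s)
  nest-spec m q fresh visits zero t _ reads S with visits t (λ i → reads i z≤n) S
  ... | extends few printed seen covered = extends few printed seen
    (λ (t′ , t′≗t , gen) → covered (generates-cong m (λ i → t′≗t i z≤n) gen))
  nest-spec m q fresh visits (suc j) t {Cs} {s} j<M reads S =
    conclude (for-invariant-out (tuple j) p I {s} (fresh-nest q fresh j j ≤-refl) base step)
    where
    p = nest j q
    Reads : Store → Set
    Reads s = ∀ i → suc j ≤ i → i < suc m + suc m → s (tuple i) 0 ≡ toℕ (t i)
    Q : ℕ → Subset n → Set
    Q b Z = ∃[ t′ ] (toℕ (t′ j) < b ×
                     (∀ i → suc j ≤ i → i < suc m + suc m → t′ i ≡ t i) × Generates (suc m) t′ Z)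
    I : ℕ → List ℕ → Store → Set
    I b o s = Reads s × Extends Cs (Q b) (b * n ^ j) o s
    conclude : I n _ _ → Extends Cs (GeneratedAbove (suc m) (suc j) t) (n ^ suc j) _ _
    conclude (_ , extends few printed seen covered) = extends few printed seen
      (λ (t′ , t′≗t , gen) → covered (t′ , Fin.toℕ<n (t′ j) , t′≗t , gen))
    reads-tick : ∀ s x → Reads s → Reads (s [ tuple j , 0 ↦ x ])
    reads-tick s x reads i j<i i<M =
      trans (update-other s (tuple j) 0 x 0 (≢⇒not (λ i≡j → <⇒≢ j<i (sym i≡j)))) (reads i j<i i<M)
    seen-tick : ∀ {Cs s} x → Seen Cs s → Seen Cs (s [ tuple j , 0 ↦ x ])
    seen-tick {s = s} x = seen-cong (kids-update s (tuple j) 0 x _ _) refl (λ _ → refl)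
    base : I 0 [] (s [ tuple j , 0 ↦ 0 ])
    base = reads-tick s 0 reads , extends-none (seen-tick 0 S) (λ ())
    step : ∀ v {o s} → s (tuple j) 0 ≡ toℕ v → I (toℕ v) o s →
           I (suc (toℕ v)) (o ++ out p s) (tick (tuple j) (run p s))
    step v {o} {s} j≡v (reads , extends {old} few printed seen covered) =
      next-step (nest-spec m q fresh visits j tᵥ (<⇒≤ j<M) readsᵥ seen)
      where
      tᵥ : ℕ → Fin n
      tᵥ i with i ≟ j
      ... | yes _ = v
      ... | no  _ = t i
      readsᵥ : ∀ i → j ≤ i → i < suc m + suc m → s (tuple i) 0 ≡ toℕ (tᵥ i)
      readsᵥ i j≤i i<M with i ≟ j
      ... | yes refl = j≡v
      ... | no  i≢j  = reads i (≤∧≢⇒< j≤i (λ j≡i → i≢j (sym j≡i))) i<M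
      agree : ∀ t′ → t′ j ≡ v → (∀ i → suc j ≤ i → i < suc m + suc m → t′ i ≡ t i) →
              ∀ i → j ≤ i → i < suc m + suc m → t′ i ≡ tᵥ i
      agree t′ t′j≡v t′≗t i j≤i i<M with i ≟ j
      ... | yes refl = t′j≡v
      ... | no  i≢j  = t′≗t i (≤∧≢⇒< j≤i (λ j≡i → i≢j (sym j≡i))) i<M
      next-step : Extends (Cs ++ old) (GeneratedAbove (suc m) j tᵥ) (n ^ j) (out p s) (run p s) →
                  I (suc (toℕ v)) (o ++ out p s) (tick (tuple j) (run p s))
      next-step (extends {new} few′ printed′ seen′ covered′) =
        reads-tick (run p s) (suc (run p s (tuple j) 0))
          (λ i j<i i<M → trans (frame p (fresh-nest q fresh j i (<⇒≤ j<i)) s 0) (reads i j<i i<M)) ,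
        extends
          (≤-trans (≤-reflexive (List.length-++ old))
            (≤-trans (+-mono-≤ few few′) (≤-reflexive (+-comm (toℕ v * n ^ j) (n ^ j)))))
          (trans (cong₂ _++_ printed printed′) (sym (List.concatMap-++ (λ S → map bit (toList S)) old new)))
          (subst (λ Ds → Seen Ds (tick (tuple j) (run p s))) assoc (seen-tick (suc (run p s (tuple j) 0)) seen′))
          (λ {Z} q → subst (Z ∈ˡ_) assoc (cover q))
        where
        assoc = List.++-assoc Cs old new
        cover : ∀ {Z} → Q (suc (toℕ v)) Z → Z ∈ˡ (Cs ++ old) ++ new
        cover (t′ , t′j≤v , t′≗t , gen) with m≤n⇒m<n∨m≡n (s≤s⁻¹ t′j≤v)
        ... | inj₁ t′j<v = ∈-++⁺ˡ (covered (t′ , t′j<v , t′≗t , gen))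
        ... | inj₂ t′j≡v = covered′ (t′ , agree t′ (Fin.toℕ-injective t′j≡v) t′≗t , gen)

-- The output of the whole algorithm

wellFormed-algorithm : ∀ m → WellFormed (algorithm m)
wellFormed-algorithm m = tt , wellFormed-nest (core m) (λ i → _) _ (m + m)

Output : ∀ {n} → FinGraph n → Prog → ℕ → Set
Output {n} G p bound = ∃[ Cs ] (Lists Cs (IsMinimalSeparator G) × length Cs ≤ bound
                               × Semantics.out G p empty ≡ encode Cs)

algorithm-spec : ∀ m {n} (G : FinGraph n) → ImmatureCreatureFree (suc (suc m)) G →
                 Output G (algorithm (suc m)) (n ^ (suc m + suc m))
algorithm-spec m {zero}  G free = [] , ([] , λ Z → mk⇔ (λ ()) λ { (_ , _ , (() , _) , _) }) , z≤n , refl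
algorithm-spec m {suc n} G free = conclude
  -- Every entry is chosen by a loop, so the outer assignment is an arbitrary default. It needs a
  -- vertex, hence the separate case of the empty graph.
  (nest-spec m (core (suc m)) (λ i → _) (core-spec m) (suc m + suc m) (λ _ → zero) ≤-refl
    (λ i M≤i i<M → contradiction i<M (≤⇒≯ M≤i)) initial)
  where
  open Semantics G
  open GraphProperties G
  open Evaluation G
  initial : Seen [] (empty [ next , 0 ↦ 2 ])
  initial = record
    { trie    = record
      { dead      = λ { false → refl ; true → refl }
      ; bounded   = λ { false _ → z<s ; true _ → z<s }
      ; nonroot   = λ { false _ () ; true _ () }
      ; injective = λ { {false} ≢0 _ → contradiction refl ≢0 ; {true} ≢0 _ → contradiction refl ≢0 }
      ; 2≤M       = ≤-refl }
    ; marked  = λ ()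
    ; only    = λ _ ≢0 → contradiction refl ≢0
    ; unique  = []
    ; minimal = λ () }
  conclude : ∀ {b o s} → Extends [] (GeneratedAbove (suc m) (suc m + suc m) (λ _ → zero)) b o s →
    ∃[ Cs ] (Lists Cs (IsMinimalSeparator G) × length Cs ≤ b × o ≡ encode Cs)
  conclude (extends {Cs} few printed seen covered) =
    Cs , (Seen.unique seen , λ Z → mk⇔ (Seen.minimal seen) (λ minimal →
      let t , generates = minimal⇒cut free minimal in
      covered (t , (λ i M≤i i<M → contradiction i<M (≤⇒≯ M≤i)) , generates))) , few , printed

-- Edgeless graphs, the case k = 1

edgeless : ∀ {n} (G : FinGraph n) → ImmatureCreatureFree 1 G → ∀ {u v} → ¬ Adj G u v
edgeless G free {u} {v} u~v = free _ (proj₂ (creature {1} (λ _ → u) (λ _ → v)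
  (λ { _ _ refl → Adj-irrefl u~v })
  (λ { zero zero → mk⇔ (λ _ → refl) (λ _ → u~v) })))
  where open GraphProperties G

-- For k = 1 the tuples would be empty and could not name two components by their first entries.
-- Instead, the untouched array `sep` is printed, the zero vector of the empty set, which is a
-- minimal separator of an edgeless graph exactly if there are at least two vertices.
edgeless-algorithm : Prog
edgeless-algorithm = cond (lt (lit 1) order) (for row (prt (sep ! var row))) nop

edgeless-spec : ∀ {n} (G : FinGraph n) → ImmatureCreatureFree 1 G → Output G edgeless-algorithm 1
edgeless-spec {0} G free = [] , ([] , λ Z → mk⇔ (λ ()) λ { (_ , _ , (() , _) , _) }) , z≤n , refl
edgeless-spec {1} G free =
  [] , ([] , λ Z → mk⇔ (λ ()) λ { (_ , _ , cL@(zero , _ , _ , L⊇) , cR@(zero , _ , _ , R⊇) , L≢R , _) →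
    contradiction (components-disjoint cL cR (L⊇ ε) (R⊇ ε)) L≢R }) , z≤n , refl
  where open GraphProperties G
edgeless-spec {suc (suc n)} G free =
  ∅ ∷ [] , (All.[] ∷ [] , λ Z → mk⇔ (λ { (here refl) → ∅-minimal }) (λ minimal → here (minimal⇒∅ minimal)))
  , ≤-refl , trans (print-spec (mkBits (λ v → no ∉⊥ , refl))) (sym (List.++-identityʳ _))
  where
  open Evaluation G
  no-edge = edgeless G free
  singleton : ∀ v → IsComponent G ∅ ⁅ v ⁆
  singleton v = v , ∉⊥ ,
    (λ w∈ → subst (Reachable G ∅ v) (sym (x∈⁅y⁆⇒x≡y v w∈)) ε) ,
    (λ { ε → x∈⁅x⁆ v ; ((_ , _ , v~w) ◅ _) → contradiction v~w no-edge })
  neighbourhood : ∀ L → N G L ≐ (_∈ ∅)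
  neighbourhood L = (λ (_ , _ , _ , u~v) → contradiction u~v no-edge) , (λ v∈∅ → contradiction v∈∅ ∉⊥)
  ∅-minimal : IsMinimalSeparator G ∅
  ∅-minimal = ⁅ zero ⁆ , ⁅ suc zero ⁆ , singleton zero , singleton (suc zero) , (λ ())
            , neighbourhood ⁅ zero ⁆ , neighbourhood ⁅ suc zero ⁆
  minimal⇒∅ : ∀ {Z} → IsMinimalSeparator G Z → Z ≡ ∅
  minimal⇒∅ (L , _ , _ , _ , _ , (_ , Z⊆N) , _) = ⊆-antisym
    (λ v∈Z → let _ , _ , _ , v~u = Z⊆N v∈Z in contradiction v~u no-edge)
    (λ v∈∅ → contradiction v∈∅ ∉⊥)

-- The bound is claimed for n ≥ 1 because `n ^ d` may vanish at n = 0, where the program still takes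
-- time.
enumeration : ∀ p d {b n} (G : FinGraph n) → WellFormed p → depth p ≤ d → Output G p b →
  ∃[ Cs ] ∃[ t ] (Lists Cs (IsMinimalSeparator G) × Prints (compile p) G Cs t × (1 ≤ n → t ≤ coeff p * n ^ d))
enumeration p d {n = n} G wf depth≤d (Cs , lists , _ , printed) =
  let t , t≤ , r = halts p wf empty in
  Cs , t , lists , (run p empty , subst (λ o → Run G (compile p) empty t o (run p empty)) printed r) ,
  λ 1≤n → ≤-trans t≤ (raise (coeff p) n {{>-nonZero 1≤n}} depth≤d (time-bound p n {{>-nonZero 1≤n}}))
  where open Semantics G

counting : ∀ {n b b′} (G : FinGraph n) p → b ≤ b′ → Output G p b →
  ∃[ Cs ] (Lists Cs (IsMinimalSeparator G) × length Cs ≤ b′)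
counting G p b≤b′ (Cs , lists , few , _) = Cs , lists , ≤-trans few b≤b′

theorem1p5 : ∀ (k : ℕ) → 1 ≤ k →
    (∃[ c ] (∀ {n} (G : FinGraph n) → ImmatureCreatureFree k G →
    ∃[ Cs ] (Lists Cs (IsMinimalSeparator G) × length Cs ≤ c * n ^ (2 * k ∸ 2))))
    ×
    (∃[ p ] ∃[ c ] (∀ {n} (G : FinGraph n) → ImmatureCreatureFree k G →
    ∃[ Cs ] ∃[ t ] (Lists Cs (IsMinimalSeparator G) × Prints p G Cs t × (1 ≤ n → t ≤ c * n ^ (2 * k)))))
theorem1p5 (suc zero) _ =
  (1 , λ G free → counting G edgeless-algorithm ≤-refl (edgeless-spec G free)) ,
  (compile edgeless-algorithm , coeff edgeless-algorithm ,
   λ G free → enumeration edgeless-algorithm 2 G _ (s≤s z≤n) (edgeless-spec G free))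
theorem1p5 (suc (suc m)) _ =
  (1 , λ {n} G free → counting G p (≤-reflexive (count-bound n)) (algorithm-spec m G free)) ,
  (compile p , coeff p ,
   λ G free → enumeration p (2 * suc (suc m)) G (wellFormed-algorithm (suc m)) depth≤ (algorithm-spec m G free))
  where
  p = algorithm (suc m)
  -- The last 2 is the loop depth of `core`: n rounds of a search, or n vertices to be dominated,
  -- each with a scan of all vertices.
  exponent : 2 * suc (suc m) ≡ suc m + suc m + 2
  exponent = begin
    suc (suc m) + (suc (suc m) + 0)  ≡⟨ cong (suc (suc m) +_) (+-identityʳ (suc (suc m))) ⟩
    suc (suc m) + suc (suc m)        ≡⟨ cong suc (+-suc (suc m) (suc m)) ⟩
    2 + (suc m + suc m)              ≡⟨ +-comm 2 (suc m + suc m) ⟩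
    suc m + suc m + 2                ∎
    where open ≡-Reasoning
  count-bound : ∀ n → n ^ (suc m + suc m) ≡ 1 * n ^ (2 * suc (suc m) ∸ 2)
  count-bound n = trans
    (cong (n ^_) (sym (trans (cong (_∸ 2) exponent) (m+n∸n≡m (suc m + suc m) 2))))
    (sym (*-identityˡ _))
  depth≤ : depth p ≤ 2 * suc (suc m)
  depth≤ = ≤-reflexive (trans (depth-nest (core (suc m)) (suc m + suc m)) (sym exponent))
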